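{- If $G$ is a planar ribbon graph, then the action $\beta_v$ of $\operatorname{Pic}^0(G)$ on $S(G)$ is independent of the vertex $v$, and hence defines a canonical action $\beta$ of $\operatorname{Pic}^0(G)$ on $S(G)$.
   Context: A graph means a finite connected multigraph without loop edges; a ribbon graph is a graph with a cyclic ordering of the edges around each vertex. A ribbon graph is planar if it can be embedded in $\mathbb{R}^2$ without crossings so that the cyclic orderings are those induced by the counterclockwise orientation of the plane (equivalently, the closed orientable surface determined by the ribbon structure has genus $0$). $S(G)$ is the set of spanning trees. Divisors are formal integer combinations of vertices. For $f : V(G) \to \mathbb{Z}$, $\Delta f = \sum_{u} \big(\sum_{\text{edges } uw} (f(u)-f(w))\big)(u)$; $D \sim D'$ if $D - D' = \Delta f$ for some $f$. $\operatorname{Pic}^d(G)$ is the set of linear equivalence classes of degree-$d$ divisors; $\operatorname{Pic}^0(G)$ is a group. The genus is $g = |E(G)|-|V(G)|+1$. For a spanning tree $T$ with non-tree edges $e_1,\dots,e_g$, a $T$-break divisor is $\sum_i (v_i)$ with $v_i$ an endpoint of $e_i$; $B(G)$ is the set of all such (over all $T$). Every class in $\operatorname{Pic}^g(G)$ contains exactly one element of $B(G)$, and $\operatorname{Pic}^0(G)$ acts on $B(G)$ by $\gamma \cdot D :=$ the unique break divisor linearly equivalent to $D + \gamma$. Bernardi map: for a vertex $v$, an edge $e$ incident to $v$, and a spanning tree $T$, the tour starts at $v$ and examines edges at $v$ in cyclic order starting with $e$; at a current vertex $u$, an examined edge $f \notin T$ is "cut through" from $u$ and the next edge at $u$ is examined,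 while an examined edge $f \in T$ is walked along to its other endpoint $u'$, after which the edges at $u'$ are examined in cyclic order starting with the edge after $f$. The tour ends when each tree edge has been traversed in both directions. For $f \notin T$, $\eta_{(v,e)}(f)$ is the endpoint from which $f$ is first cut through, and $\beta_{(v,e)}(T) = \sum_{f \notin T} (\eta_{(v,e)}(f))$; $\beta_{(v,e)} : S(G) \to B(G)$ is a bijection. The action $\beta_v$ is $\gamma \cdot T := \beta_{(v,e)}^{ -1}(\gamma \cdot \beta_{(v,e)}(T))$ for any edge $e$ incident to $v$ (independent of $e$). -}

module Defs where

open import Algebra.Bundles using (AbelianGroup)
open import Data.Bool.Base using (Bool; true; false; not; if_then_else_)
open import Data.Fin.Base using (Fin; zero; suc)
import Data.Fin.Properties as Fin
open import Data.Fin.Subset using (Subset; _∈_; _∉_; ⊤)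
open import Data.Fin.Subset.Properties using (_∈?_)
open import Data.Integer.Base using (ℤ; 0ℤ; 1ℤ; _+_; _-_; -_)
import Data.Integer.Properties as ℤ
open import Data.Integer.Tactic.RingSolver using (solve-∀)
open import Data.List.Base using (List; []; _∷_; map)
open import Data.List.Relation.Unary.All using (All)
open import Data.List.Relation.Unary.Unique.Propositional using (Unique)
open import Data.Nat.Base as ℕ using (ℕ; _<_)
open import Data.Nat.GeneralisedArithmetic using (fold)
open import Data.Product.Base using (∃-syntax; Σ-syntax; _×_; _,_; proj₁)
open import Data.Vec.Functional using (Vector)
open import Function.Base using (_∘_)
open import Function.Bundles using (_↔_; _⇔_; Inverse)
open import Function.Definitions using (StrictlySurjective)
open import Level using (Level; _⊔_)
open import Relation.Binary.Bundles using (Setoid)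
open import Relation.Binary.PropositionalEquality
  using (_≡_; _≢_; _≗_; refl; sym; trans; cong; cong₂)
open import Relation.Nullary.Decidable.Core using (does)
open import Relation.Nullary.Negation using (¬_)

import Algebra.Properties.CommutativeMonoid.Sum ℤ.+-0-commutativeMonoid as ℤΣ
open ℤΣ using (sum)

-- Each edge consists of two darts (half-edges) (e , false) and (e , true);
-- since there are no loops, a dart is the same as a pair (v , e) of a vertex
-- and an edge incident to it.
module Darts (n m : ℕ) (end : Fin m × Bool → Fin n) where

  Vertex Edge Dart : Set
  Vertex = Fin n
  Edge   = Fin m
  Dart   = Edge × Bool

  edge : Dart → Edge
  edge = proj₁

  opposite : Dart → Dart
  opposite (e , b) = e , not b

  src tgt : Dart → Vertex
  src d = end d
  tgt d = end (opposite d)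

  IsWalk : Vertex → List Dart → Vertex → Set
  IsWalk u []       w = u ≡ w
  IsWalk u (d ∷ ds) w = src d ≡ u × IsWalk (tgt d) ds w

  Within : Subset m → List Dart → Set
  Within S = All (λ d → edge d ∈ S)

  -- The spanning subgraph with edge set S is connected.
  Connected : Subset m → Set
  Connected S = ∀ u w → ∃[ ds ] IsWalk u ds w × Within S ds

  -- A cycle is a nonempty closed walk repeating neither a vertex nor an edge.
  -- Edges must be mentioned: a pair of parallel edges is a cycle, whereas
  -- going back and forth along one edge is not.
  Acyclic : Subset m → Set
  Acyclic S = ∀ u ds → IsWalk u ds u → Within S ds →
              Unique (map src ds) → Unique (map edge ds) → ds ≡ []

record Graph : Set where
  field
    n m : ℕ
    end : Fin m × Bool → Fin n

  open Darts n m end public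

  field
    nonempty  : 0 < n
    loopless  : ∀ d → src d ≢ tgt d
    connected : Connected ⊤

record RibbonGraph : Set where
  field
    graph : Graph

  open Graph graph public

  field
    next : Dart ↔ Dart

  succ : Dart → Dart
  succ = Inverse.to next

  field
    succ-src   : ∀ d → src (succ d) ≡ src d
    succ-cycle : ∀ d d′ → src d ≡ src d′ → ∃[ k ] fold d succ k ≡ d′

HasOrbits : {A : Set} → (A → A) → ℕ → Set
HasOrbits {A} f k =
  Σ[ c ∈ (A → Fin k) ]
    StrictlySurjective _≡_ c ×
    (∀ x y → c x ≡ c y ⇔ (∃[ i ] fold x f i ≡ y))

module _ (R : RibbonGraph) where
  open RibbonGraph R

  -- The boundary components of the thickened graph are the orbits of this
  -- permutation, and gluing a disc to each gives the closed surface of R.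
  faceStep : Dart → Dart
  faceStep d = succ (opposite d)

  -- n - m + F = 2 - 2g.  The one-vertex graph has no darts, but its
  -- thickening, a disc, does have one boundary component; hence F = k ⊔ 1.
  HasGenus : ℕ → Set
  HasGenus g =
    ∃[ k ] HasOrbits faceStep k × n ℕ.+ (k ℕ.⊔ 1) ℕ.+ 2 ℕ.* g ≡ m ℕ.+ 2

  Planar : Set
  Planar = HasGenus 0

module _ (G : Graph) where
  open Graph G

  Divisor : Set
  Divisor = Vertex → ℤ

  _⊕_ : Divisor → Divisor → Divisor
  (D ⊕ D′) u = D u + D′ u

  ⊝_ : Divisor → Divisor
  (⊝ D) u = - D u

  point : Vertex → Divisor
  point v u = if does (u Fin.≟ v) then 1ℤ else 0ℤ

  degree : Divisor → ℤ
  degree = sum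

  outflow : (Vertex → ℤ) → Vertex → Dart → ℤ
  outflow f u d = if does (src d Fin.≟ u) then f (src d) - f (tgt d) else 0ℤ

  edgeFlow : (Vertex → ℤ) → Vertex → Edge → ℤ
  edgeFlow f u e = outflow f u (e , false) + outflow f u (e , true)

  Δ : (Vertex → ℤ) → Divisor
  Δ f u = sum (edgeFlow f u)

  infix 4 _∼_
  _∼_ : Divisor → Divisor → Set
  D ∼ D′ = ∃[ f ] ∀ u → D u - D′ u ≡ Δ f u

  outflow-+ : ∀ f g u d →
    outflow (λ w → f w + g w) u d ≡ outflow f u d + outflow g u d
  outflow-+ f g u d with does (src d Fin.≟ u)
  ... | false = refl
  ... | true  = lemma (f (src d)) (g (src d)) (f (tgt d)) (g (tgt d))
    where
    lemma : ∀ a b c e → (a + b) - (c + e) ≡ (a - c) + (b - e)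
    lemma = solve-∀

  outflow-neg : ∀ f u d → outflow (λ w → - f w) u d ≡ - outflow f u d
  outflow-neg f u d with does (src d Fin.≟ u)
  ... | false = refl
  ... | true  = lemma (f (src d)) (f (tgt d))
    where
    lemma : ∀ a c → - a - (- c) ≡ - (a - c)
    lemma = solve-∀

  outflow-0 : ∀ u d → outflow (λ _ → 0ℤ) u d ≡ 0ℤ
  outflow-0 u d with does (src d Fin.≟ u)
  ... | false = refl
  ... | true  = refl

  sum-neg : ∀ {k} (t : Vector ℤ k) → sum (λ i → - t i) ≡ - sum t
  sum-neg {ℕ.zero}  t = refl
  sum-neg {ℕ.suc k} t = trans
    (cong (- t zero +_) (sum-neg (t ∘ suc)))
    (sym (ℤ.neg-distrib-+ (t zero) (sum (t ∘ suc))))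

  Δ-+ : ∀ f g u → Δ (λ w → f w + g w) u ≡ Δ f u + Δ g u
  Δ-+ f g u = trans
    (ℤΣ.sum-cong-≗ λ e → trans
      (cong₂ _+_ (outflow-+ f g u (e , false)) (outflow-+ f g u (e , true)))
      (lemma (outflow f u (e , false)) (outflow g u (e , false))
             (outflow f u (e , true))  (outflow g u (e , true))))
    (ℤΣ.∑-distrib-+ (edgeFlow f u) (edgeFlow g u))
    where
    lemma : ∀ a b c d → (a + b) + (c + d) ≡ (a + c) + (b + d)
    lemma = solve-∀

  Δ-neg : ∀ f u → Δ (λ w → - f w) u ≡ - Δ f u
  Δ-neg f u = trans
    (ℤΣ.sum-cong-≗ λ e → trans
      (cong₂ _+_ (outflow-neg f u (e , false)) (outflow-neg f u (e , true)))
      (sym (ℤ.neg-distrib-+ (outflow f u (e , false)) _)))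
    (sum-neg (edgeFlow f u))

  Δ-0 : ∀ u → Δ (λ _ → 0ℤ) u ≡ 0ℤ
  Δ-0 u = trans
    (ℤΣ.sum-cong-≗ λ e →
      cong₂ _+_ (outflow-0 u (e , false)) (outflow-0 u (e , true)))
    (ℤΣ.sum-replicate-zero m)

  ∼-reflexive : ∀ {D D′} → D ≗ D′ → D ∼ D′
  ∼-reflexive {D} {D′} eq = (λ _ → 0ℤ) , λ u →
    trans (ℤ.i≡j⇒i-j≡0 (eq u)) (sym (Δ-0 u))

  ∼-sym : ∀ {D D′} → D ∼ D′ → D′ ∼ D
  ∼-sym {D} {D′} (f , p) = (λ w → - f w) , λ u → trans
    (trans (lemma (D u) (D′ u)) (cong -_ (p u)))
    (sym (Δ-neg f u))
    where
    lemma : ∀ a b → b - a ≡ - (a - b)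
    lemma = solve-∀

  ∼-trans : ∀ {D D′ D″} → D ∼ D′ → D′ ∼ D″ → D ∼ D″
  ∼-trans {D} {D′} {D″} (f , p) (g , q) = (λ w → f w + g w) , λ u → trans
    (trans (lemma (D u) (D′ u) (D″ u)) (cong₂ _+_ (p u) (q u)))
    (sym (Δ-+ f g u))
    where
    lemma : ∀ a b c → a - c ≡ (a - b) + (b - c)
    lemma = solve-∀

  ∼-⊕ : ∀ {D D′ E E′} → D ∼ D′ → E ∼ E′ → (D ⊕ E) ∼ (D′ ⊕ E′)
  ∼-⊕ {D} {D′} {E} {E′} (f , p) (g , q) = (λ w → f w + g w) , λ u → trans
    (trans (lemma (D u) (D′ u) (E u) (E′ u)) (cong₂ _+_ (p u) (q u)))
    (sym (Δ-+ f g u))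
    where
    lemma : ∀ a b c d → (a + c) - (b + d) ≡ (a - b) + (c - d)
    lemma = solve-∀

  ∼-⊝ : ∀ {D D′} → D ∼ D′ → (⊝ D) ∼ (⊝ D′)
  ∼-⊝ {D} {D′} (f , p) = (λ w → - f w) , λ u → trans
    (trans (lemma (D u) (D′ u)) (cong -_ (p u)))
    (sym (Δ-neg f u))
    where
    lemma : ∀ a b → - a - (- b) ≡ - (a - b)
    lemma = solve-∀

  Div⁰ : Set
  Div⁰ = Σ[ D ∈ Divisor ] degree D ≡ 0ℤ

  Pic⁰ : AbelianGroup _ _
  Pic⁰ = record
    { Carrier = Div⁰
    ; _≈_     = λ D D′ → proj₁ D ∼ proj₁ D′
    ; _∙_     = λ { (D , p) (D′ , p′) →
                    D ⊕ D′ , trans (ℤΣ.∑-distrib-+ D D′) (cong₂ _+_ p p′) }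
    ; ε       = (λ _ → 0ℤ) , ℤΣ.sum-replicate-zero n
    ; _⁻¹     = λ { (D , p) → ⊝ D , trans (sum-neg D) (cong -_ p) }
    ; isAbelianGroup = record
      { isGroup = record
        { isMonoid = record
          { isSemigroup = record
            { isMagma = record
              { isEquivalence = record
                { refl  = λ {D} → ∼-reflexive {proj₁ D} (λ _ → refl)
                ; sym   = λ {D} {D′} → ∼-sym {proj₁ D} {proj₁ D′}
                ; trans = λ {D} {D′} {D″} →
                          ∼-trans {proj₁ D} {proj₁ D′} {proj₁ D″}
                }
              ; ∙-cong = λ {D} {D′} {E} {E′} →
                         ∼-⊕ {proj₁ D} {proj₁ D′} {proj₁ E} {proj₁ E′}
              }
            ; assoc = λ D D′ D″ → ∼-reflexive λ u →
                      ℤ.+-assoc (proj₁ D u) (proj₁ D′ u) (proj₁ D″ u)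
            }
          ; identity = (λ D → ∼-reflexive λ u → ℤ.+-identityˡ (proj₁ D u))
                     , (λ D → ∼-reflexive λ u → ℤ.+-identityʳ (proj₁ D u))
          }
        ; inverse = (λ D → ∼-reflexive λ u → ℤ.+-inverseˡ (proj₁ D u))
                  , (λ D → ∼-reflexive λ u → ℤ.+-inverseʳ (proj₁ D u))
        ; ⁻¹-cong = λ {D} {D′} → ∼-⊝ {proj₁ D} {proj₁ D′}
        }
      ; comm = λ D D′ → ∼-reflexive λ u → ℤ.+-comm (proj₁ D u) (proj₁ D′ u)
      }
    }

  record SpanningTree : Set where
    field
      edges      : Subset m
      connecting : Connected edges
      acyclic    : Acyclic edges

  open SpanningTree

  -- A spanning tree is its edge set; the proofs are not compared.
  SpanningTrees : Setoid _ _
  SpanningTrees = record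
    { Carrier       = SpanningTree
    ; _≈_           = λ T T′ → edges T ≡ edges T′
    ; isEquivalence = record { refl = refl ; sym = sym ; trans = trans }
    }

  -- The sum over the edges e outside T of the endpoint c e of e; the values
  -- of c on T are irrelevant.
  chips : SpanningTree → (Edge → Bool) → Divisor
  chips T c u = sum λ e →
    if does (e ∈? edges T) then 0ℤ else point (src (e , c e)) u

  IsBreak : Divisor → Set
  IsBreak D = Σ[ T ∈ SpanningTree ] ∃[ c ] D ≗ chips T c

  -- D′ is γ · D in the action of Pic⁰ on break divisors.
  IsTranslate : Div⁰ → Divisor → Divisor → Set
  IsTranslate γ D D′ = IsBreak D′ × D′ ∼ (D ⊕ proj₁ γ)

module _ (R : RibbonGraph) where
  open RibbonGraph R
  open SpanningTree

  -- Examining the dart d means examining its edge at the vertex src d.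
  tourStep : SpanningTree graph → Dart → Dart
  tourStep T d =
    if does (edge d ∈? edges T) then succ (opposite d) else succ d

  -- The dart examined at time k (if the tour has not ended yet).
  tour : SpanningTree graph → Dart → ℕ → Dart
  tour T d = fold d (tourStep T)

  Ended : SpanningTree graph → Dart → ℕ → Set
  Ended T d k = ∀ x → edge x ∈ edges T → ∃[ j ] j < k × tour T d j ≡ x

  -- Before the end of the tour, the edge of x is cut through from src x, not
  -- having been cut through before.  It is meant for edge x ∉ edges T.
  FirstCut : SpanningTree graph → Dart → Dart → Set
  FirstCut T d x = ∃[ k ]
    ¬ Ended T d k × tour T d k ≡ x × (∀ j → j < k → edge (tour T d j) ≢ edge x)

  -- β₍ᵥ,ₑ₎(T) = D, where d is the dart of e at v; c is the map η₍ᵥ,ₑ₎.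
  IsBernardi : Dart → SpanningTree graph → Divisor graph → Set
  IsBernardi d T D = Σ[ c ∈ (Edge → Bool) ]
    (∀ e → e ∉ edges T → FirstCut T d (e , c e)) × D ≗ chips graph T c

  -- T′ = γ · T in the action βᵥ, where v = src d and βᵥ is computed with the
  -- edge of d:  β₍ᵥ,ₑ₎(T′) = γ · β₍ᵥ,ₑ₎(T).
  BernardiAction : Dart → Div⁰ graph →
                   SpanningTree graph → SpanningTree graph → Set
  BernardiAction d γ T T′ = ∃[ D ] ∃[ D′ ]
    IsBernardi d T D × IsTranslate graph γ D D′ × IsBernardi d T′ D′

record Action {a b c d : Level} (G : AbelianGroup a b) (X : Setoid c d) :
              Set (a ⊔ b ⊔ c ⊔ d) where
  private
    module G = AbelianGroup G
    module X = Setoid X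
  infixr 7 _▷_
  field
    _▷_      : G.Carrier → X.Carrier → X.Carrier
    ▷-cong   : ∀ {g h x y} → g G.≈ h → x X.≈ y → (g ▷ x) X.≈ (h ▷ y)
    identity : ∀ x → (G.ε ▷ x) X.≈ x
    compat   : ∀ g h x → ((g G.∙ h) ▷ x) X.≈ (g ▷ (h ▷ x))

-- Fix a starting dart d, with source q.  For any spanning tree, the tour is a
-- single cycle through all darts, in which the darts beyond a tree edge form
-- an interval.
--
-- Independence of v.  Replacing d by the next dart at q changes β_d(T) by a
-- class independent of T: either one edge is cut at its other end, or all the
-- cotree edges between the two sides of a tree edge are, which is the
-- Laplacian of the indicator of a side.  Replacing d by its opposite does
-- likewise if no two cotree edges interlace along the tour; if two of them
-- did, the remaining ones would connect the dual graph, and be too few for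
-- that by Euler's formula.  So the class of β_d(T′) - β_d(T) is independent
-- of d.
--
-- Orient tree edges away from q and every other edge towards its chip.  Then
-- β_d(T) is, up to a constant divisor, the indegree of an orientation O_T in
-- which q reaches everything.  Two such orientations with equivalent
-- indegrees have equal indegrees, and O_T determines T because the first
-- difference between two tours is seen in the indegrees beyond a tree edge.
-- Conversely, any class is reached by reversing directed cuts and paths, and
-- given O with q reaching everything, a tour that cuts through an edge
-- whenever some orientation with the same indegrees and the same past allows
-- it traces out a spanning tree T for which O_T has the indegrees of O.

module Submission where

open import Defs
open import Algebra.Bundles using (AbelianGroup)
import Algebra.Properties.CommutativeMonoid.Sum
import Algebra.Properties.Semiring.Sum
open import Data.Bool.Base using (Bool; true; false; not; if_then_else_; _xor_; _∧_)
import Data.Bool.Properties as Bool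
open import Data.Empty using (⊥; ⊥-elim)
open import Data.Fin.Base using (Fin; zero; suc; toℕ; combine; punchIn; punchOut)
import Data.Fin.Properties as Fin
open import Data.Fin.Subset using (Subset; _∈_; _∉_)
open import Data.Fin.Subset.Properties using (_∈?_; anySubset?)
open import Data.Integer.Base as ℤ using (ℤ; 0ℤ; 1ℤ; _+_; _-_; -_; _*_; _≤_; -[1+_])
import Data.Integer.Properties as ℤ
open import Data.Integer.Tactic.RingSolver using (solve-∀)
open import Data.List.Base using (List; []; _∷_; map)
open import Data.List.Relation.Unary.All as All using (All; []; _∷_)
import Data.List.Relation.Unary.All.Properties as All
open import Data.List.Relation.Unary.AllPairs using ([]; _∷_)
open import Data.List.Relation.Unary.Unique.Propositional using (Unique)
open import Data.Nat.Base as ℕ using (ℕ; zero; suc; z≤n; s≤s)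
open import Data.Nat.GeneralisedArithmetic using (fold)
import Data.Nat.Properties as ℕ
open import Data.Product.Base using (∃-syntax; Σ-syntax; _×_; _,_; proj₁; proj₂)
import Data.Product.Properties as Product
open import Data.Sum.Base using (_⊎_; inj₁; inj₂)
open import Data.Unit.Base using (⊤; tt)
open import Data.Vec.Base using (lookup; tabulate)
open import Data.Vec.Functional using (updateAt)
open import Data.Vec.Functional.Properties using (updateAt-updates; updateAt-minimal)
open import Data.Vec.Properties using (lookup∘tabulate; tabulate∘lookup; tabulate-cong; []=⇒lookup; lookup⇒[]=)
open import Function.Base using (_∘_; const; case_of_)
open import Function.Bundles using (_⇔_; mk⇔; Equivalence; Inverse)
open import Relation.Binary.Bundles using (Setoid)
open import Relation.Binary.Definitions using (DecidableEquality; tri<; tri≈; tri>)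
open import Relation.Binary.PropositionalEquality
open import Relation.Nullary.Decidable using (Dec; yes; no; does; dec-true; dec-false; map′; ¬?; _×-dec_; decidable-stable)
open import Relation.Nullary.Negation using (¬_; contradiction)

-- Neither the uniqueness of break divisors in a class nor the bijectivity of the Bernardi map is
-- available beforehand. The relation `BernardiAction` is the graph of a function only if the
-- classes of the Bernardi divisors are distinct and exhaust all classes of their degree, and
-- orientations are used to prove exactly this. The constant divisor is the sum of all vertices
-- minus `q`, since each vertex other than `q` is the head of exactly one tree edge. Surjectivity is
-- delicate because the tour must decide about an edge before the tree is known. At every time the
-- construction therefore carries a whole spanning tree and a whole orientation, and alters them
-- only at edges not yet visited, so that the past of the tour stays the same. Connectedness,
-- reachability and faces are expressed by functions that are constant or monotone along edges. This
-- replaces surgery on walks by sums and Boolean algebra; simple walks are needed only in passing to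
-- and from `SpanningTree`.

module ℤΣ = Algebra.Properties.CommutativeMonoid.Sum ℤ.+-0-commutativeMonoid
open ℤΣ using (sum)
module ℤΣ* = Algebra.Properties.Semiring.Sum ℤ.+-*-semiring

-- Booleans, counting and finite sums

bool-case : ∀ {ℓ} {P : Set ℓ} (b : Bool) → (b ≡ true → P) → (b ≡ false → P) → P
bool-case true  t f = t refl
bool-case false t f = f refl

true≢false : ∀ {b} → b ≡ true → b ≡ false → ⊥
true≢false refl ()

if-true : ∀ {A : Set} {b} {x y : A} → b ≡ true → (if b then x else y) ≡ x
if-true refl = refl

if-false : ∀ {A : Set} {b} {x y : A} → b ≡ false → (if b then x else y) ≡ y
if-false refl = refl

does-true : ∀ {ℓ} {P : Set ℓ} (p? : Dec P) → does p? ≡ true → P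
does-true (yes p) _ = p

does-false : ∀ {ℓ} {P : Set ℓ} (p? : Dec P) → does p? ≡ false → ¬ P
does-false (no ¬p) _ = ¬p

least : {P : ℕ → Set} → (∀ k → Dec (P k)) → ∀ k → P k →
        ∃[ j ] P j × (∀ i → i ℕ.< j → ¬ P i)
least P? zero    p = zero , p , λ _ ()
least {P} P? (suc k) p with P? zero
... | yes p₀ = zero , p₀ , λ _ ()
... | no ¬p₀ =
  let j , pj , min = least (λ i → P? (suc i)) k p
  in  suc j , pj , λ { zero _ → ¬p₀ ; (suc i) (s≤s i<j) → min i i<j }

count : ∀ {k} → (Fin k → Bool) → ℕ
count {zero}  r = 0
count {suc k} r = (if r zero then 1 else 0) ℕ.+ count (r ∘ suc)

count-not : ∀ {k} (r : Fin k → Bool) → count r ℕ.+ count (not ∘ r) ≡ k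
count-not {zero}  r = refl
count-not {suc k} r with r zero
... | true  = cong suc (count-not (r ∘ suc))
... | false = trans (ℕ.+-suc (count (r ∘ suc)) _) (cong suc (count-not (r ∘ suc)))

count-remove : ∀ {k} (r : Fin k → Bool) i → r i ≡ true →
               suc (count (updateAt r i (const false))) ≡ count r
count-remove r zero    eq rewrite eq = refl
count-remove r (suc i) eq =
  trans (sym (ℕ.+-suc (if r zero then 1 else 0) _))
        (cong ((if r zero then 1 else 0) ℕ.+_) (count-remove (r ∘ suc) i eq))

count-cong : ∀ {k} {r r′ : Fin k → Bool} → r ≗ r′ → count r ≡ count r′
count-cong {zero}  eq = refl
count-cong {suc k} eq =
  cong₂ ℕ._+_ (cong (if_then 1 else 0) (eq zero)) (count-cong (eq ∘ suc))

insert : ∀ {k} → Fin k → (Fin k → Bool) → (Fin k → Bool)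
insert v p = updateAt p v (const true)

insert-count : ∀ {k} (p : Fin k → Bool) v → p v ≡ false →
               suc (count (not ∘ insert v p)) ≡ count (not ∘ p)
insert-count p v pv = trans (cong suc (sym (count-cong swap)))
                            (count-remove (not ∘ p) v (cong not pv))
  where
  swap : ∀ u → updateAt (not ∘ p) v (const false) u ≡ not (insert v p u)
  swap u with u Fin.≟ v
  ... | yes refl = trans (updateAt-updates u (not ∘ p))
                         (cong not (sym (updateAt-updates u p)))
  ... | no u≢v   = trans (updateAt-minimal u v (not ∘ p) u≢v)
                         (cong not (sym (updateAt-minimal u v p u≢v)))

-- The number of indices outside `p` drops at every insertion, so the recursion ends. It serves
-- twice: for the set reached from `q` in an orientation and for the component of a vertex in a
-- subgraph.
grow : ∀ {k} (P : (Fin k → Bool) → Set) {Q : Set} →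
       (∀ p → P p → Q ⊎ (∃[ v ] p v ≡ false × P (insert v p))) →
       ∀ p → P p → Q
grow P {Q} step p = go (count (not ∘ p)) p refl
  where
  go : ∀ c p → count (not ∘ p) ≡ c → P p → Q
  go c p eq pp with step p pp
  go c       p eq pp | inj₁ q = q
  go zero    p eq pp | inj₂ (v , pv , _)
    with () ← trans (insert-count p v pv) eq
  go (suc c) p eq pp | inj₂ (v , pv , pp′) =
    go c (insert v p) (ℕ.suc-injective (trans (insert-count p v pv) eq)) pp′

-- A graph on k vertices, all of whose Boolean 0-cocycles are constant, has at
-- least k - 1 edges: contracting an edge loses at most one vertex.
connected-count : ∀ {k l} (ends : Fin l → Fin k × Fin k) (r : Fin l → Bool) →
  (∀ (p : Fin k → Bool) →
     (∀ i → r i ≡ true → p (proj₁ (ends i)) ≡ p (proj₂ (ends i))) →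
     ∀ a b → p a ≡ p b) →
  k ℕ.≤ suc (count r)
connected-count {zero}        {zero}  ends r con = z≤n
connected-count {suc zero}    {zero}  ends r con = s≤s z≤n
connected-count {suc (suc k)} {zero}  ends r con
  -- At least two vertices and no edge left: the indicator of one vertex is a cocycle that is not
  -- constant.
  with () ← con (λ { zero → true ; (suc _) → false }) (λ ()) zero (suc zero)
connected-count {k} {suc l} ends r con with r zero in eq
... | false = connected-count (ends ∘ suc) (r ∘ suc) λ p inv →
  con p λ { zero r₀ → contradiction (trans (sym r₀) eq) λ () ; (suc i) → inv i }
... | true with ends zero in eqe
...   | a , b with a Fin.≟ b
...     | yes refl = ℕ.m≤n⇒m≤1+n (connected-count (ends ∘ suc) (r ∘ suc) λ p inv →
  con p λ { zero _ → cong p (trans (cong proj₁ eqe) (sym (cong proj₂ eqe)))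
          ; (suc i) → inv i })
...     | no a≢b with k
...       | suc k = s≤s (connected-count
    (λ i → merge (proj₁ (ends (suc i))) , merge (proj₂ (ends (suc i)))) (r ∘ suc)
    λ p inv x y → trans (cong p (sym (merge-punchIn x))) (trans
      (con (p ∘ merge)
           (λ { zero _ → cong p (trans (cong (merge ∘ proj₁) eqe)
                           (trans merge-ab (cong (merge ∘ proj₂) (sym eqe))))
              ; (suc i) → inv i })
           (punchIn a x) (punchIn a y))
      (cong p (merge-punchIn y))))
  where
  merge : Fin (suc k) → Fin k
  merge i with a Fin.≟ i
  ... | yes _  = punchOut a≢b
  ... | no a≢i = punchOut a≢i
  merge-punchIn : ∀ x → merge (punchIn a x) ≡ x
  merge-punchIn x with a Fin.≟ punchIn a x
  ... | yes e  = contradiction (sym e) (Fin.punchInᵢ≢i a x)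
  ... | no a≢i = trans (Fin.punchOut-cong a refl) (Fin.punchOut-punchIn a)
  merge-ab : merge a ≡ merge b
  merge-ab with a Fin.≟ a | a Fin.≟ b
  ... | no a≢a | _ = contradiction refl a≢a
  ... | yes _ | yes e = contradiction e a≢b
  ... | yes _ | no _ = Fin.punchOut-cong a refl

sum-zero : ∀ {k} {t : Fin k → ℤ} → (∀ i → t i ≡ 0ℤ) → sum t ≡ 0ℤ
sum-zero {k} eq = trans (ℤΣ.sum-cong-≗ eq) (ℤΣ.sum-replicate-zero k)

sum-single : ∀ {k} (t : Fin k → ℤ) i → (∀ j → j ≢ i → t j ≡ 0ℤ) → sum t ≡ t i
sum-single t zero    eq = trans
  (cong (t zero +_) (sum-zero λ j → eq (suc j) λ ())) (ℤ.+-identityʳ _)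
sum-single t (suc i) eq = trans
  (cong₂ _+_ (eq zero λ ()) (sum-single (t ∘ suc) i λ j j≢i → eq (suc j) (j≢i ∘ Fin.suc-injective)))
  (ℤ.+-identityˡ _)

sum-nonneg : ∀ {k} (t : Fin k → ℤ) → (∀ i → 0ℤ ≤ t i) → 0ℤ ≤ sum t
sum-nonneg {zero}  t nn = ℤ.≤-refl
sum-nonneg {suc k} t nn = ℤ.+-mono-≤ (nn zero) (sum-nonneg (t ∘ suc) (nn ∘ suc))

nonneg-sum-zero : ∀ {k} (t : Fin k → ℤ) → (∀ i → 0ℤ ≤ t i) → sum t ≡ 0ℤ →
                  ∀ i → t i ≡ 0ℤ
nonneg-sum-zero {suc k} t nn eq = λ { zero → t₀≡0 ; (suc i) → nonneg-sum-zero (t ∘ suc) (nn ∘ suc) rest i }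
  where
  s = sum (t ∘ suc)
  t₀≤0 : t zero ≤ 0ℤ
  t₀≤0 = ℤ.≤-trans (ℤ.≤-reflexive (sym (ℤ.+-identityʳ _)))
    (ℤ.≤-trans (ℤ.+-monoʳ-≤ (t zero) (sum-nonneg (t ∘ suc) (nn ∘ suc)))
               (ℤ.≤-reflexive eq))
  t₀≡0 : t zero ≡ 0ℤ
  t₀≡0 = ℤ.≤-antisym t₀≤0 (nn zero)
  rest : s ≡ 0ℤ
  rest = trans (sym (ℤ.+-identityˡ s)) (trans (cong (_+ s) (sym t₀≡0)) eq)

insert-here : ∀ {k} v (p : Fin k → Bool) → insert v p v ≡ true
insert-here v p = updateAt-updates v p

insert-there : ∀ {k} v (p : Fin k → Bool) {u} → p u ≡ true → insert v p u ≡ true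
insert-there v p {u} pu with u Fin.≟ v
... | yes refl = insert-here v p
... | no u≢v   = trans (updateAt-minimal u v p u≢v) pu

-- A function is recovered from its table only up to pointwise equality, hence the hypothesis
-- `resp`. This makes the search through all orientations in `improvable?` decidable.
any-function? : ∀ {k} {P : (Fin k → Bool) → Set} → (∀ {f g} → f ≗ g → P f → P g) →
                (∀ f → Dec (P f)) → Dec (∃[ f ] P f)
any-function? resp P? = map′
  (λ (S , p) → lookup S , p)
  (λ (f , p) → tabulate f , resp (λ i → sym (lookup∘tabulate f i)) p)
  (anySubset? (λ S → P? (lookup S)))

xor-true : ∀ {a b} → a xor b ≡ true → a ≢ b
xor-true {true}  {true}  ()
xor-true {false} {false} ()
xor-true {true}  {false} _ ()
xor-true {false} {true}  _ ()

xor-cancelʳ : ∀ {a b} c → a xor c ≡ b xor c → a ≡ b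
xor-cancelʳ {true}  {true}  c _  = refl
xor-cancelʳ {false} {false} c _  = refl
xor-cancelʳ {true}  {false} true  ()
xor-cancelʳ {true}  {false} false ()
xor-cancelʳ {false} {true}  true  ()
xor-cancelʳ {false} {true}  false ()

xor-≢ : ∀ {a b} → a ≢ b → a xor b ≡ true
xor-≢ {true}  {true}  neq = contradiction refl neq
xor-≢ {false} {false} neq = contradiction refl neq
xor-≢ {true}  {false} _   = refl
xor-≢ {false} {true}  _   = refl

does-∈? : ∀ {k} (S : Subset k) e → does (e ∈? S) ≡ lookup S e
does-∈? S e with e ∈? S
... | yes e∈S = sym ([]=⇒lookup e∈S)
... | no e∉S  = sym (Bool.¬-not λ eq → e∉S (lookup⇒[]= e S eq))

-- This fails for fractions: here the integrality of the functions in linear equivalence enters the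
-- uniqueness of rooted indegrees.
i≤i*i : ∀ i → i ≤ i * i
i≤i*i (ℤ.+ zero)   = ℤ.≤-refl
i≤i*i (ℤ.+ suc n)  = ℤ.+≤+ (ℕ.m≤m*n (suc n) (suc n))
i≤i*i (-[1+ n ]) = ℤ.-≤+

0≤i*i : ∀ i → 0ℤ ≤ i * i
0≤i*i (ℤ.+ n)      = ℤ.≤-trans (ℤ.+≤+ z≤n) (ℤ.≤-reflexive (ℤ.pos-* n n))
0≤i*i (-[1+ n ]) = ℤ.+≤+ z≤n

i*i≡0⇒i≡0 : ∀ i → i * i ≡ 0ℤ → i ≡ 0ℤ
i*i≡0⇒i≡0 i eq with ℤ.i*j≡0⇒i≡0∨j≡0 i eq
... | inj₁ e = e
... | inj₂ e = e

-- Cyclic order of the iterates of an injection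

module Iteration {A : Set} (τ : A → A) (τ-injective : ∀ {x y} → τ x ≡ τ y → x ≡ y) where

  fold-+ : ∀ d i j → fold d τ (i ℕ.+ j) ≡ fold (fold d τ j) τ i
  fold-+ d zero    j = refl
  fold-+ d (suc i) j = cong τ (fold-+ d i j)

  fold-injective : ∀ i {x y} → fold x τ i ≡ fold y τ i → x ≡ y
  fold-injective zero    eq = eq
  fold-injective (suc i) eq = fold-injective i (τ-injective eq)

  fold-cancel : ∀ {x y i j} → j ℕ.≤ i → fold x τ i ≡ fold y τ j → fold x τ (i ℕ.∸ j) ≡ y
  fold-cancel {x} {y} {i} {j} j≤i eq = fold-injective j (trans
    (sym (fold-+ x j (i ℕ.∸ j)))
    (trans (cong (fold x τ) (ℕ.m+[n∸m]≡n j≤i)) eq))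

  module Finite {N : ℕ} (code : A → Fin N)
                (code-injective : ∀ {x y} → code x ≡ code y → x ≡ y)
                (_≟_ : DecidableEquality A) where

    repeats : ∀ d → ∃[ i ] ∃[ j ] i ℕ.< j × j ℕ.≤ N × fold d τ i ≡ fold d τ j
    repeats d =
      let i , j , i<j , eq = Fin.pigeonhole {m = N} {n = suc N} ℕ.≤-refl (λ i → code (fold d τ (toℕ i)))
      in  toℕ i , toℕ j , i<j , ℕ.s≤s⁻¹ (Fin.toℕ<n j) , code-injective eq

    returns : ∀ d → ∃[ k ] fold d τ (suc k) ≡ d
    returns d with repeats d
    ... | i , suc j , s≤s i≤j , _ , eq = j ℕ.∸ i ,
      trans (cong (fold d τ) (sym (ℕ.+-∸-assoc 1 i≤j)))
            (fold-cancel (ℕ.m≤n⇒m≤1+n i≤j) (sym eq))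

    -- Apply the hypothesis to the indicator of the orbit of `d`. As the orbit returns to `d` after
    -- `suc k` steps, membership is decided by searching one period, which is closed under `τ` in
    -- both directions.
    reaches : (∀ (X : A → Bool) → (∀ y → X (τ y) ≡ X y) → ∀ y z → X y ≡ X z) →
              ∀ d y → ∃[ k ] fold d τ k ≡ y
    reaches constant d y with returns d
    ... | k , ret = let i , _ , eq = found y (trans (constant X invariant y d) Xd)
                    in  i , eq
      where
      On : A → Set
      On y = ∃[ i ] i ℕ.< suc k × fold d τ i ≡ y
      on? : ∀ y → Dec (On y)
      on? y = ℕ.anyUpTo? (λ i → fold d τ i ≟ y) (suc k)
      X : A → Bool
      X y = does (on? y)
      found : ∀ y → X y ≡ true → On y
      found y eq with on? y
      ... | yes p = p
      Xd : X d ≡ true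
      Xd = dec-true (on? d) (0 , s≤s z≤n , refl)
      forth : ∀ {y} → On y → On (τ y)
      forth (i , s≤s i≤k , refl) with ℕ.m≤n⇒m<n∨m≡n i≤k
      ... | inj₁ i<k  = suc i , s≤s i<k , refl
      ... | inj₂ refl = 0 , s≤s z≤n , sym ret
      back : ∀ {y} → On (τ y) → On y
      back (zero  , _ , eq) = k , ℕ.≤-refl , τ-injective (trans ret eq)
      back (suc i , i<k , eq) = i , ℕ.<-trans ℕ.≤-refl i<k , τ-injective eq
      invariant : ∀ y → X (τ y) ≡ X y
      invariant y with on? y
      ... | yes p = dec-true (on? (τ y)) (forth p)
      ... | no ¬p = dec-false (on? (τ y)) (¬p ∘ back)

  module Cycle (_≟_ : DecidableEquality A) (reach : ∀ d y → ∃[ k ] fold d τ k ≡ y) where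

    abstract
      private
        first-visit : ∀ d y → ∃[ k ] fold d τ k ≡ y × (∀ i → i ℕ.< k → fold d τ i ≢ y)
        first-visit d y =
          least (λ k → fold d τ k ≟ y) (proj₁ (reach d y)) (proj₂ (reach d y))

      pos : A → A → ℕ
      pos d y = proj₁ (first-visit d y)

      at-pos : ∀ d y → fold d τ (pos d y) ≡ y
      at-pos d y = proj₁ (proj₂ (first-visit d y))

      pos-least : ∀ {d y k} → fold d τ k ≡ y → pos d y ℕ.≤ k
      pos-least {d} {y} {k} eq = ℕ.≮⇒≥ λ k<pos → proj₂ (proj₂ (first-visit d y)) k k<pos eq

    pos-start : ∀ d → pos d d ≡ 0
    pos-start d = ℕ.n≤0⇒n≡0 (pos-least refl)

    pos-injective : ∀ {d y z} → pos d y ≡ pos d z → y ≡ z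
    pos-injective {d} {y} {z} eq =
      trans (sym (at-pos d y)) (trans (cong (fold d τ) eq) (at-pos d z))

    -- If the element at time `k` had already appeared at a time `q < k`, skipping the steps in
    -- between would lead to `y` before time `pos d y`.
    pos-at : ∀ {d y k} → k ℕ.≤ pos d y → pos d (fold d τ k) ≡ k
    pos-at {d} {y} {k} k≤p = ℕ.≤-antisym p≤k (ℕ.≮⇒≥ λ q<k →
      let q = pos d (fold d τ k) ; p = pos d y
          eq : fold d τ ((p ℕ.∸ k) ℕ.+ q) ≡ y
          eq = trans (fold-+ d (p ℕ.∸ k) q) (trans (cong (λ w → fold w τ (p ℕ.∸ k)) (at-pos d _))
                (trans (sym (fold-+ d (p ℕ.∸ k) k)) (trans (cong (fold d τ) (ℕ.m∸n+n≡m k≤p)) (at-pos d y))))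
      in  ℕ.<-irrefl refl (ℕ.≤-<-trans (pos-least eq)
            (ℕ.<-≤-trans (ℕ.+-monoʳ-< (p ℕ.∸ k) q<k) (ℕ.≤-reflexive (ℕ.m∸n+n≡m k≤p)))))
      where
      p≤k : pos d (fold d τ k) ℕ.≤ k
      p≤k = pos-least refl

    -- `z` certifies that `y` is not the last element of the cycle, from which `τ` returns to
    -- position 0.
    pos-τ : ∀ {d y z} → pos d y ℕ.< pos d z → pos d (τ y) ≡ suc (pos d y)
    pos-τ {d} {y} {z} lt =
      trans (cong (pos d ∘ τ) (sym (at-pos d y))) (pos-at {d} {z} lt)

    along : ∀ {B : Set} (X : A → B) d {i l} → i ℕ.≤ l →
            (∀ k → i ℕ.≤ k → k ℕ.< l → X (τ (fold d τ k)) ≡ X (fold d τ k)) →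
            X (fold d τ i) ≡ X (fold d τ l)
    along X d {i} {l} i≤l inv with ℕ.m≤n⇒m<n∨m≡n i≤l
    ... | inj₂ refl = refl
    along X d {i} {suc l} i≤l inv | inj₁ (s≤s i≤l′) =
      trans (along X d i≤l′ (λ k i≤k k<l → inv k i≤k (ℕ.m≤n⇒m≤1+n k<l)))
            (sym (inv l i≤l′ ℕ.≤-refl))

    constant-on-arc : ∀ {B : Set} (X : A → B) d {y z} → pos d y ℕ.≤ pos d z →
      (∀ w → pos d y ℕ.≤ pos d w → pos d w ℕ.< pos d z → X (τ w) ≡ X w) →
      X y ≡ X z
    constant-on-arc X d {y} {z} y≤z inv = trans (cong X (sym (at-pos d y)))
      (trans (along X d y≤z λ k y≤k k<z →
                let e = pos-at {d} {z} (ℕ.<⇒≤ k<z) in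
                inv (fold d τ k) (ℕ.≤-trans y≤k (ℕ.≤-reflexive (sym e)))
                                 (ℕ.≤-<-trans (ℕ.≤-reflexive e) k<z))
             (cong X (at-pos d z)))

    module _ (d d′ : A) where
      private j = pos d d′

      pos-after : ∀ {y} → j ℕ.≤ pos d y → pos d′ y ℕ.+ j ≡ pos d y
      pos-after {y} j≤p = ℕ.≤-antisym
        (ℕ.≤-trans (ℕ.+-monoˡ-≤ j (pos-least {d′}
            (trans (cong (λ w → fold w τ (pos d y ℕ.∸ j)) (sym (at-pos d d′)))
              (trans (sym (fold-+ d (pos d y ℕ.∸ j) j))
                (trans (cong (fold d τ) (ℕ.m∸n+n≡m j≤p)) (at-pos d y))))))
          (ℕ.≤-reflexive (ℕ.m∸n+n≡m j≤p)))
        (pos-least (trans (fold-+ d (pos d′ y) j)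
          (trans (cong (λ w → fold w τ (pos d′ y)) (at-pos d d′)) (at-pos d′ y))))

      -- Go back from `y` along the iterations from `d` and from `d′`: the shorter one meets its
      -- start on the way of the longer one. As `y` comes before `d′` when starting at `d`, it is
      -- `d` that lies on the way from `d′`.
      wraps : ∀ {y} → pos d y ℕ.< j → pos d′ d ℕ.≤ pos d′ y
      wraps {y} p<j with ℕ.≤-total (pos d y) (pos d′ y)
      ... | inj₁ p≤a = ℕ.≤-trans
        (pos-least (fold-cancel p≤a (trans (at-pos d′ y) (sym (at-pos d y)))))
        (ℕ.m∸n≤m _ (pos d y))
      ... | inj₂ a≤p = contradiction
        (ℕ.≤-trans (pos-least (fold-cancel a≤p (trans (at-pos d y) (sym (at-pos d′ y)))))
                   (ℕ.m∸n≤m _ (pos d′ y)))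
        (ℕ.<⇒≱ p<j)

      swaps : ∀ {y z} → pos d y ℕ.< j → j ℕ.≤ pos d z → pos d′ z ℕ.< pos d′ y
      swaps {y} {z} p<j j≤z = ℕ.<-≤-trans (ℕ.≰⇒> λ i≤b → ℕ.<-irrefl refl
          (ℕ.<-≤-trans (ℕ.≤-<-trans z≤n p<j) (ℕ.+-cancelˡ-≤ (pos d′ z) j 0
            (ℕ.≤-trans (ℕ.≤-reflexive (pos-after j≤z))
              (ℕ.≤-trans (pos≤ i≤b) (ℕ.≤-reflexive (sym (ℕ.+-identityʳ _))))))))
        (wraps p<j)
        where
        pos≤ : pos d′ d ℕ.≤ pos d′ z → pos d z ℕ.≤ pos d′ z
        pos≤ i≤b = ℕ.≤-trans
          (pos-least (trans
            (cong (λ w → fold w τ (pos d′ z ℕ.∸ pos d′ d)) (sym (at-pos d′ d)))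
            (trans (sym (fold-+ d′ (pos d′ z ℕ.∸ pos d′ d) (pos d′ d)))
              (trans (cong (fold d′ τ) (ℕ.m∸n+n≡m i≤b)) (at-pos d′ z)))))
          (ℕ.m∸n≤m _ (pos d′ d))

      keeps-after : ∀ {y z} → j ℕ.≤ pos d y → pos d y ℕ.< pos d z → pos d′ y ℕ.< pos d′ z
      keeps-after j≤y y<z = ℕ.+-cancelʳ-< j _ _ (ℕ.<-≤-trans
        (ℕ.≤-<-trans (ℕ.≤-reflexive (pos-after j≤y)) y<z)
        (ℕ.≤-reflexive (sym (pos-after (ℕ.≤-trans j≤y (ℕ.<⇒≤ y<z))))))

    -- Seen from `d′`, both elements come after `d`, so this is `pos-after` with the two starts
    -- exchanged.
    keeps-before : ∀ d d′ {y z} → pos d y ℕ.< pos d z → pos d z ℕ.< pos d d′ →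
                   pos d′ y ℕ.< pos d′ z
    keeps-before d d′ {y} {z} y<z z<j = ℕ.<-≤-trans
      (ℕ.≤-<-trans (ℕ.≤-reflexive (sym (pos-after d′ d (wraps d d′ (ℕ.<-trans y<z z<j)))))
                   (ℕ.+-monoˡ-< (pos d′ d) y<z))
      (ℕ.≤-reflexive (pos-after d′ d (wraps d d′ z<j)))

    module Bounded {N : ℕ} (code : A → Fin N)
                   (code-injective : ∀ {x y} → code x ≡ code y → x ≡ y) where

      pos-bound : ∀ d y → pos d y ℕ.< N
      pos-bound d y = ℕ.≮⇒≥ λ N<p →
        let i , j , i<j , eq = Fin.pigeonhole N<p (λ i → code (fold d τ (toℕ i)))
            bound : ∀ (i : Fin (suc (pos d y))) → pos d (fold d τ (toℕ i)) ≡ toℕ i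
            bound i = pos-at {d} {y} (ℕ.s≤s⁻¹ (Fin.toℕ<n i))
        in  ℕ.<-irrefl (trans (sym (bound i))
              (trans (cong (pos d) (code-injective eq)) (bound j))) i<j

-- Divisors and rooted orientations of a graph

module GraphLemmas (G : Graph) where
  open Graph G

  opposite-involutive : ∀ x → opposite (opposite x) ≡ x
  opposite-involutive (e , b) = cong (e ,_) (Bool.not-involutive b)

  opposite-≢ : ∀ {x} → opposite x ≢ x
  opposite-≢ {e , true}  ()
  opposite-≢ {e , false} ()

  tgt-opposite : ∀ x → tgt (opposite x) ≡ src x
  tgt-opposite x = cong src (opposite-involutive x)

  same-edge : ∀ {x y} → edge y ≡ edge x → y ≡ x ⊎ y ≡ opposite x
  same-edge {e , true}  {e , true}  refl = inj₁ refl
  same-edge {e , true}  {e , false} refl = inj₂ refl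
  same-edge {e , false} {e , true}  refl = inj₂ refl
  same-edge {e , false} {e , false} refl = inj₁ refl

  _≟ᵈ_ : DecidableEquality Dart
  _≟ᵈ_ = Product.≡-dec Fin._≟_ Bool._≟_

  code : Dart → Fin (m ℕ.* 2)
  code (e , b) = combine e (if b then suc zero else zero)

  code-injective : ∀ {x y} → code x ≡ code y → x ≡ y
  code-injective {e , b} {e′ , b′} eq with Fin.combine-injective e _ e′ _ eq
  code-injective {e , true}  {e , true}  eq | refl , _ = refl
  code-injective {e , false} {e , false} eq | refl , _ = refl

  constant-on-walk : ∀ {A : Set} (S : Dart → Set) (p : Vertex → A) →
    (∀ y → S y → p (src y) ≡ p (tgt y)) →
    ∀ u ds w → IsWalk u ds w → All S ds → p u ≡ p w
  constant-on-walk S p inv u []       w refl _ = refl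
  constant-on-walk S p inv u (d ∷ ds) w (refl , walk) (sd ∷ sds) =
    trans (inv d sd) (constant-on-walk S p inv (tgt d) ds w walk sds)

  -- The first dart of a walk from `u`; an empty walk means that `u` is the source of `d`. Some dart
  -- has to be given, since a one-vertex graph has none.
  dart-at : Dart → ∀ u → ∃[ y ] src y ≡ u
  dart-at d u with connected u (src d)
  ... | []     , refl , _ = d , refl
  ... | y ∷ _ , (eq , _) , _ = y , eq

  connected-constant : ∀ {A : Set} (p : Vertex → A) →
    (∀ y → p (src y) ≡ p (tgt y)) → ∀ u w → p u ≡ p w
  connected-constant p inv u w =
    let ds , walk , _ = connected u w
    in  constant-on-walk (const ⊤) p (λ y _ → inv y) u ds w walk (All.universal (λ _ → tt) ds)

  -- s is the fundamental cut of the dart x: the component of tgt x after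
  -- edge x has been removed from t.
  record IsSide (t : Edge → Bool) (x : Dart) (s : Vertex → Bool) : Set where
    constructor is-side
    field
      near      : s (src x) ≡ false
      far       : s (tgt x) ≡ true
      uncrossed : ∀ y → t (edge y) ≡ true → edge y ≢ edge x → s (src y) ≡ s (tgt y)

  -- A spanning tree without walks: `joins` is connectedness, phrased by Boolean cocycles, and `cut`
  -- is acyclicity, as an edge on no cycle is the only edge of `t` in some cut. `member-tree` and
  -- `to-spanning-tree` relate this form to `SpanningTree`.
  record Tree (t : Edge → Bool) : Set where
    field
      joins : ∀ (p : Vertex → Bool) →
              (∀ x → t (edge x) ≡ true → p (src x) ≡ p (tgt x)) →
              ∀ u w → p u ≡ p w
      cut   : ∀ x → t (edge x) ≡ true → ∃[ s ] IsSide t x s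

    constant : ∀ {A : Set} → DecidableEquality A → (p : Vertex → A) →
               (∀ x → t (edge x) ≡ true → p (src x) ≡ p (tgt x)) →
               ∀ u w → p u ≡ p w
    constant _≟_ p inv u w = does-true (p u ≟ p w) (trans
      (joins (λ v → does (p v ≟ p w)) (λ x tx → cong (λ a → does (a ≟ p w)) (inv x tx)) u w)
      (dec-true (p w ≟ p w) refl))

  sum-minus : ∀ {k} (s t : Fin k → ℤ) → sum (λ i → s i - t i) ≡ sum s - sum t
  sum-minus s t = trans (ℤΣ.∑-distrib-+ s (λ i → - t i)) (cong (sum s +_) (sum-neg G t))

  infixl 6 _⊞_
  _⊞_ : Divisor G → Divisor G → Divisor G
  _⊞_ = _⊕_ G

  -- Unlike _∼_, which unfolds, this determines its arguments.
  infix 4 _≃_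
  record _≃_ (D D′ : Divisor G) : Set where
    constructor ≃⁺
    field ≃⁻ : _∼_ G D D′
  open _≃_ public

  ≃-reflexive : ∀ {D D′} → D ≗ D′ → D ≃ D′
  ≃-reflexive eq = ≃⁺ (∼-reflexive G eq)

  ≃-sym : ∀ {D D′} → D ≃ D′ → D′ ≃ D
  ≃-sym {D} {D′} (≃⁺ p) = ≃⁺ (∼-sym G {D} {D′} p)

  ≃-trans : ∀ {D D′ D″} → D ≃ D′ → D′ ≃ D″ → D ≃ D″
  ≃-trans {D} {D′} {D″} (≃⁺ p) (≃⁺ q) = ≃⁺ (∼-trans G {D} {D′} {D″} p q)

  ≃-⊞ : ∀ {D D′ E E′} → D ≃ D′ → E ≃ E′ → D ⊞ E ≃ D′ ⊞ E′
  ≃-⊞ {D} {D′} {E} {E′} (≃⁺ p) (≃⁺ q) = ≃⁺ (∼-⊕ G {D} {D′} {E} {E′} p q)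

  ⟨_⟩ : Vertex → Divisor G
  ⟨ v ⟩ = point G v

  point-≡ : ∀ {u v} → u ≡ v → ⟨ v ⟩ u ≡ 1ℤ
  point-≡ {u} {v} eq = cong (if_then 1ℤ else 0ℤ) (dec-true (u Fin.≟ v) eq)

  point-≢ : ∀ {u v} → u ≢ v → ⟨ v ⟩ u ≡ 0ℤ
  point-≢ {u} {v} neq = cong (if_then 1ℤ else 0ℤ) (dec-false (u Fin.≟ v) neq)

  sum-point : ∀ (h : Vertex → ℤ) v → sum (λ u → h u * ⟨ v ⟩ u) ≡ h v
  sum-point h v = trans
    (sum-single _ v λ u u≢v → trans (cong (h u *_) (point-≢ u≢v)) (ℤ.*-zeroʳ (h u)))
    (trans (cong (h v *_) (point-≡ {v} refl)) (ℤ.*-identityʳ (h v)))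

  -- An orientation O directs each edge e towards its end src (e , O e).
  indegree : (Edge → Bool) → Divisor G
  indegree O u = sum λ e → ⟨ src (e , O e) ⟩ u

  indegree-cong : ∀ {O O′} → O ≗ O′ → indegree O ≗ indegree O′
  indegree-cong eq u = ℤΣ.sum-cong-≗ λ e → cong (λ b → ⟨ src (e , b) ⟩ u) (eq e)

  outflow-point : ∀ f u d → outflow G f u d ≡ (f (src d) - f (tgt d)) * ⟨ src d ⟩ u
  outflow-point f u d with src d Fin.≟ u | u Fin.≟ src d
  ... | yes _ | yes _ = sym (ℤ.*-identityʳ _)
  ... | no _  | no _  = sym (ℤ.*-zeroʳ (f (src d) - f (tgt d)))
  ... | yes e | no ¬e = contradiction (sym e) ¬e
  ... | no ¬e | yes e = contradiction (sym e) ¬e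

  -- Both factors change sign under `opposite`, so the formula holds for either dart of the edge and
  -- later proofs may take the one that suits them.
  edgeFlow-point : ∀ f u y → edgeFlow G f u (edge y) ≡
                   (f (src y) - f (tgt y)) * (⟨ src y ⟩ u - ⟨ tgt y ⟩ u)
  edgeFlow-point f u (e , b) = trans
    (cong₂ _+_ (outflow-point f u (e , false)) (outflow-point f u (e , true))) (oriented b)
    where
    f₀ = f (src (e , false)) ; f₁ = f (src (e , true))
    p₀ = ⟨ src (e , false) ⟩ u ; p₁ = ⟨ src (e , true) ⟩ u
    lemma₀ : ∀ a b p q → (a - b) * p + (b - a) * q ≡ (a - b) * (p - q)
    lemma₀ = solve-∀
    lemma₁ : ∀ a b p q → (a - b) * p + (b - a) * q ≡ (b - a) * (q - p)
    lemma₁ = solve-∀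
    oriented : ∀ b → (f₀ - f₁) * p₀ + (f₁ - f₀) * p₁ ≡
      (f (src (e , b)) - f (tgt (e , b))) * (⟨ src (e , b) ⟩ u - ⟨ tgt (e , b) ⟩ u)
    oriented false = lemma₀ f₀ f₁ p₀ p₁
    oriented true  = lemma₁ f₀ f₁ p₀ p₁

  pairing : (Vertex → ℤ) → Divisor G → ℤ
  pairing h D = sum λ u → h u * D u

  pairing-sum : ∀ {k} h (F : Fin k → Divisor G) →
    pairing h (λ u → sum λ e → F e u) ≡ sum λ e → pairing h (F e)
  pairing-sum h F = trans
    (ℤΣ.sum-cong-≗ λ u → ℤΣ*.*-distribˡ-sum (h u) (λ e → F e u))
    (ℤΣ.∑-comm λ u e → h u * F e u)

  pairing-indegree : ∀ h O → pairing h (indegree O) ≡ sum λ e → h (src (e , O e))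
  pairing-indegree h O = trans (pairing-sum h λ e → ⟨ src (e , O e) ⟩)
    (ℤΣ.sum-cong-≗ λ e → sum-point h (src (e , O e)))

  pairing-minus : ∀ h D D′ → pairing h (λ u → D u - D′ u) ≡ pairing h D - pairing h D′
  pairing-minus h D D′ = trans
    (ℤΣ.sum-cong-≗ λ u → lemma (h u) (D u) (D′ u))
    (sum-minus (λ u → h u * D u) (λ u → h u * D′ u))
    where
    lemma : ∀ a b c → a * (b - c) ≡ a * b - a * c
    lemma = solve-∀

  pairing-cong : ∀ h {D D′} → D ≗ D′ → pairing h D ≡ pairing h D′
  pairing-cong h eq = ℤΣ.sum-cong-≗ λ u → cong (h u *_) (eq u)

  slope : (Vertex → ℤ) → Edge → ℤ
  slope f e = f (src (e , false)) - f (src (e , true))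

  -- The Dirichlet energy of `f`, by summation by parts.
  pairing-Δ : ∀ f → pairing f (Δ G f) ≡ sum λ e → slope f e * slope f e
  pairing-Δ f = trans (pairing-sum f λ e u → edgeFlow G f u e)
    (ℤΣ.sum-cong-≗ λ e → let a = src (e , false) ; b = src (e , true) in trans
      (pairing-cong f λ u → trans (edgeFlow-point f u (e , false)) (distrib (slope f e) (⟨ a ⟩ u) (⟨ b ⟩ u)))
      (trans (pairing-minus f (λ u → slope f e * ⟨ a ⟩ u) (λ u → slope f e * ⟨ b ⟩ u))
        (trans (cong₂ _-_ (scaled (slope f e) a) (scaled (slope f e) b))
          (sym (distrib (slope f e) (f a) (f b))))))
    where
    distrib : ∀ a b c → a * (b - c) ≡ a * b - a * c
    distrib = solve-∀
    assoc : ∀ a b c → a * (b * c) ≡ (a * b) * c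
    assoc = solve-∀
    scaled : ∀ c v → pairing f (λ u → c * ⟨ v ⟩ u) ≡ c * f v
    scaled c v = trans (ℤΣ.sum-cong-≗ λ u → assoc (f u) c (⟨ v ⟩ u))
      (trans (sum-point (λ u → f u * c) v) (ℤ.*-comm (f v) c))

  Monotone : (Vertex → ℤ) → (Edge → Bool) → Set
  Monotone h O = ∀ e → h (src (e , not (O e))) ≤ h (src (e , O e))

  -- Equivalent to every vertex being reachable from q along O; in this form,
  -- pairing h with indegrees shows that it only depends on the indegrees.
  Rooted : Vertex → (Edge → Bool) → Set
  Rooted q O = ∀ h → Monotone h O → ∀ u → h q ≤ h u

  -- If `h` is monotone along `O′`, then the head of each edge in `O′` carries the larger of its two
  -- values. By pairing `h` with the indegrees, the values at the heads have equal sums for `O` and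
  -- `O′`, so they agree edge by edge and `h` is monotone along `O` too.
  Rooted-indegree : ∀ {q O O′} → indegree O ≗ indegree O′ → Rooted q O → Rooted q O′
  Rooted-indegree {q} {O} {O′} eq rooted h mono = rooted h λ e →
    ℤ.≤-trans (proj₁ (best e)) (ℤ.≤-reflexive (sym (same e)))
    where
    best : ∀ e → h (src (e , not (O e))) ≤ h (src (e , O′ e)) × h (src (e , O e)) ≤ h (src (e , O′ e))
    best e with O e | O′ e | mono e
    ... | false | false | le = le , ℤ.≤-refl
    ... | false | true  | le = ℤ.≤-refl , le
    ... | true  | false | le = ℤ.≤-refl , le
    ... | true  | true  | le = le , ℤ.≤-refl
    same : ∀ e → h (src (e , O e)) ≡ h (src (e , O′ e))
    same e = sym (ℤ.i-j≡0⇒i≡j _ _ (nonneg-sum-zero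
      (λ e → h (src (e , O′ e)) - h (src (e , O e)))
      (λ e → ℤ.i≤j⇒0≤j-i (proj₂ (best e)))
      (trans (sum-minus (λ e → h (src (e , O′ e))) (λ e → h (src (e , O e)))) (ℤ.i≡j⇒i-j≡0
        (trans (sym (pairing-indegree h O′))
          (trans (pairing-cong h (λ u → sym (eq u))) (pairing-indegree h O)))))
      e))

  -- If indegree O - indegree O′ = Δ f, pairing with f gives
  -- Σₑ (∂f)² = Σₑ (f (head of e in O) - f (head of e in O′)); each edge makes
  -- the left side at least as large as the right, so f increases along O and
  -- decreases along O′.
  Rooted-unique : ∀ {q O O′} → Rooted q O → Rooted q O′ →
                  indegree O ≃ indegree O′ → indegree O ≗ indegree O′
  Rooted-unique {q} {O} {O′} rooted rooted′ (≃⁺ (f , eq)) u = ℤ.i-j≡0⇒i≡j _ _ (trans (eq u)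
    (sum-zero λ e → trans (edgeFlow-point f u (e , false))
      (trans (cong (_* _) (ℤ.i≡j⇒i-j≡0 (trans (f-constant _) (sym (f-constant _)))))
             (ℤ.*-zeroˡ (⟨ src (e , false) ⟩ u - ⟨ tgt (e , false) ⟩ u)))))
    where
    head head′ : Edge → ℤ
    head  e = f (src (e , O e))
    head′ e = f (src (e , O′ e))
    excess : Edge → ℤ
    excess e = slope f e * slope f e - (head e - head′ e)
    slope-minus : ∀ a b → b - a ≤ (a - b) * (a - b)
    slope-minus a b = ℤ.≤-trans (i≤i*i (b - a)) (ℤ.≤-reflexive (lemma a b))
      where
      lemma : ∀ a b → (b - a) * (b - a) ≡ (a - b) * (a - b)
      lemma = solve-∀
    excess-nonneg : ∀ e → 0ℤ ≤ excess e
    excess-nonneg e = ℤ.i≤j⇒0≤j-i (bound e)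
      where
      bound : ∀ e → head e - head′ e ≤ slope f e * slope f e
      bound e with O e | O′ e
      ... | false | false = ℤ.≤-trans (ℤ.≤-reflexive (ℤ.+-inverseʳ (f (src (e , false))))) (0≤i*i (slope f e))
      ... | true  | true  = ℤ.≤-trans (ℤ.≤-reflexive (ℤ.+-inverseʳ (f (src (e , true))))) (0≤i*i (slope f e))
      ... | false | true  = i≤i*i (slope f e)
      ... | true  | false = slope-minus (f (src (e , false))) (f (src (e , true)))
    excess-sum : sum excess ≡ 0ℤ
    excess-sum = trans (sum-minus (λ e → slope f e * slope f e) (λ e → head e - head′ e))
      (ℤ.i≡j⇒i-j≡0 (trans (sym (pairing-Δ f)) (trans (pairing-cong f (λ u → sym (eq u)))
        (trans (pairing-minus f (indegree O) (indegree O′))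
          (trans (cong₂ _-_ (pairing-indegree f O) (pairing-indegree f O′))
            (sym (sum-minus head head′)))))))
    tight : ∀ e → slope f e * slope f e ≡ head e - head′ e
    tight e = ℤ.i-j≡0⇒i≡j _ _ (nonneg-sum-zero excess excess-nonneg excess-sum e)
    f₀ f₁ : Edge → ℤ
    f₀ e = f (src (e , false))
    f₁ e = f (src (e , true))
    level : ∀ {a b} → (a - b) * (a - b) ≡ 0ℤ → a ≡ b
    level {a} {b} eq = ℤ.i-j≡0⇒i≡j a b (i*i≡0⇒i≡0 (a - b) eq)
    sloped : ∀ {a b} c → c * c ≡ a - b → b ≤ a
    sloped c eq = ℤ.0≤i-j⇒j≤i (ℤ.≤-trans (0≤i*i c) (ℤ.≤-reflexive eq))
    both : ∀ e → f (src (e , not (O e))) ≤ f (src (e , O e)) × f (src (e , O′ e)) ≤ f (src (e , not (O′ e)))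
    both e with O e | O′ e | tight e
    ... | false | false | t = let e = level {f₀ e} {f₁ e} (trans t (ℤ.+-inverseʳ (f₀ e))) in
      ℤ.≤-reflexive (sym e) , ℤ.≤-reflexive e
    ... | true  | true  | t = let e = level {f₀ e} {f₁ e} (trans t (ℤ.+-inverseʳ (f₁ e))) in
      ℤ.≤-reflexive e , ℤ.≤-reflexive (sym e)
    ... | false | true  | t = let le = sloped (slope f e) t in le , le
    ... | true  | false | t = let le = sloped (slope f e) t in le , le
    -- `f` does not decrease along `O`, so it is least at `q`; `- f` does not decrease along `O′`,
    -- so `f` is also greatest there.
    f-constant : ∀ u → f u ≡ f q
    f-constant u = ℤ.≤-antisym
      (ℤ.neg-cancel-≤ (rooted′ (λ v → - f v) (λ e → ℤ.neg-mono-≤ (proj₂ (both e))) u))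
      (rooted f (λ e → proj₁ (both e)) u)

  module FirstDarts (pos : Dart → ℕ) (pos-injective : ∀ {y z} → pos y ≡ pos z → y ≡ z) where

    abstract
      first : Edge → Bool
      first e = does (pos (e , true) ℕ.<? pos (e , false))

      first-< : ∀ e → pos (e , first e) ℕ.< pos (e , not (first e))
      first-< e = bool-case (first e)
        (λ eq → transport (sym eq) (does-true (pos (e , true) ℕ.<? pos (e , false)) eq))
        (λ eq → transport (sym eq) (ℕ.≤∧≢⇒<
          (ℕ.≮⇒≥ (does-false (pos (e , true) ℕ.<? pos (e , false)) eq))
          λ eq → opposite-≢ (sym (pos-injective eq))))
        where
        transport : ∀ {b b′} → b ≡ b′ → pos (e , b) ℕ.< pos (e , not b) → pos (e , b′) ℕ.< pos (e , not b′)
        transport = subst (λ b → pos (e , b) ℕ.< pos (e , not b))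

      first-unique : ∀ {y} → pos y ℕ.< pos (opposite y) → first (edge y) ≡ proj₂ y
      first-unique {e , true}  lt = dec-true (pos (e , true) ℕ.<? pos (e , false)) lt
      first-unique {e , false} lt = dec-false (pos (e , true) ℕ.<? pos (e , false)) (ℕ.<-asym lt)

-- Tours of spanning trees in a ribbon graph

module Ribbon (R : RibbonGraph) where
  open RibbonGraph R
  open GraphLemmas graph

  succ-injective : ∀ {x y} → succ x ≡ succ y → x ≡ y
  succ-injective {x} {y} eq = trans (sym (Inverse.strictlyInverseʳ next x))
    (trans (cong (Inverse.from next) eq) (Inverse.strictlyInverseʳ next y))

  step : (Edge → Bool) → Dart → Dart
  step t d = if t (edge d) then succ (opposite d) else succ d

  step-tree : ∀ t {y} → t (edge y) ≡ true → step t y ≡ succ (opposite y)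
  step-tree t eq = cong (λ b → if b then _ else _) eq

  step-cotree : ∀ t {y} → t (edge y) ≡ false → step t y ≡ succ y
  step-cotree t eq = cong (λ b → if b then _ else _) eq

  step-injective : ∀ t {x y} → step t x ≡ step t y → x ≡ y
  step-injective t {x} {y} eq with t (edge x) in ex | t (edge y) in ey
  ... | false | false = succ-injective eq
  ... | true  | true  = trans (sym (opposite-involutive x))
    (trans (cong opposite (succ-injective eq)) (opposite-involutive y))
  ... | true  | false = contradiction (trans (sym ey) (trans
    (cong (t ∘ edge) (sym (succ-injective eq))) ex)) λ ()
  ... | false | true  = contradiction (trans (sym ex) (trans
    (cong (t ∘ edge) (succ-injective eq)) ey)) λ ()

  succ-invariant : ∀ {A : Set} (X : Dart → A) → (∀ y → X (succ y) ≡ X y) →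
                   ∀ {y z} → src y ≡ src z → X y ≡ X z
  succ-invariant X inv {y} {z} eq with succ-cycle y z eq
  ... | k , refl = go k
    where
    go : ∀ k → X y ≡ X (fold y succ k)
    go zero    = refl
    go (suc k) = trans (go k) (sym (inv _))

  fold-agree : ∀ t t′ d k → (∀ j → j ℕ.< k → t (edge (fold d (step t) j)) ≡ t′ (edge (fold d (step t) j))) →
               ∀ j → j ℕ.≤ k → fold d (step t) j ≡ fold d (step t′) j
  fold-agree t t′ d k eq zero    _   = refl
  fold-agree t t′ d k eq (suc j) j<k = trans
    (cong (λ b → if b then _ else _) (eq j j<k))
    (cong (step t′) (fold-agree t t′ d k eq j (ℕ.<⇒≤ j<k)))

  module TreeTour (t : Edge → Bool) (tree : Tree t) where
    open Tree tree public
    open IsSide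

    τ : Dart → Dart
    τ = step t

    abstract
      τ-injective : ∀ {x y} → τ x ≡ τ y → x ≡ y
      τ-injective = step-injective t

    open Iteration τ τ-injective public
    open Finite code code-injective _≟ᵈ_ public

    -- A cotree dart is followed by one at the same vertex, and a tree edge other than that of `x`
    -- does not cross the cut.
    side-τ : ∀ {x s z} → IsSide t x s → z ≢ x → z ≢ opposite x →
             s (src (τ z)) ≡ s (src z)
    side-τ {x} {s} {z} side z≢x z≢x* with t (edge z) in tz
    ... | false = cong s (succ-src z)
    ... | true  = trans (cong s (succ-src (opposite z))) (sym (uncrossed side z tz λ eq →
      case same-edge eq of λ { (inj₁ e) → z≢x e ; (inj₂ e) → z≢x* e }))

    τ-tree : ∀ {y} → t (edge y) ≡ true → src (τ y) ≡ tgt y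
    τ-tree ty = trans (cong src (step-tree t ty)) (succ-src _)

    τ-cotree : ∀ {y} → t (edge y) ≡ false → src (τ y) ≡ src y
    τ-cotree ty = trans (cong src (step-cotree t ty)) (succ-src _)

    -- The tour can only leave the far side of x by walking back along x.
    comes-back : ∀ {y} → t (edge y) ≡ true → ∃[ k ] fold y τ k ≡ opposite y
    comes-back {y} ty with returns y
    ... | k , ret with ℕ.anyUpTo? (λ i → fold y τ i ≟ᵈ opposite y) (suc k)
    ...   | yes (i , _ , eq) = i , eq
    ...   | no none = contradiction
      (trans (sym (stays k ℕ.≤-refl)) (trans (cong (s ∘ src) ret) (near side))) λ ()
      where
      s = proj₁ (cut y ty)
      side = proj₂ (cut y ty)
      stays : ∀ i → i ℕ.≤ k → s (src (fold y τ (suc i))) ≡ true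
      stays zero    _   = trans (cong s (τ-tree ty)) (far side)
      stays (suc i) i<k = trans
        (side-τ side
          (λ eq → true≢false (stays i (ℕ.<⇒≤ i<k)) (trans (cong (s ∘ src) eq) (near side)))
          (λ eq → none (suc i , s≤s i<k , eq)))
        (stays i (ℕ.<⇒≤ i<k))

    -- By `comes-back`, `X` agrees on the two darts of a tree edge. Since `succ y` is
    -- `τ (opposite y)` on tree edges and `τ y` elsewhere, `X` is then invariant under `succ`, hence
    -- a function of the source vertex, and `joins` makes that function constant.
    τ-invariant-constant : ∀ (X : Dart → Bool) → (∀ y → X (τ y) ≡ X y) → ∀ y z → X y ≡ X z
    τ-invariant-constant X inv y z = trans (sym (at-src refl))
      (trans (joins p p-tree (src y) (src z)) (at-src refl))
      where
      X-fold : ∀ y k → X (fold y τ k) ≡ X y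
      X-fold y zero    = refl
      X-fold y (suc k) = trans (inv _) (X-fold y k)
      X-opposite : ∀ {y} → t (edge y) ≡ true → X (opposite y) ≡ X y
      X-opposite {y} ty with comes-back ty
      ... | k , eq = trans (cong X (sym eq)) (X-fold y k)
      X-succ : ∀ y → X (succ y) ≡ X y
      X-succ y = bool-case (t (edge y))
        (λ ty → trans (cong X (trans (cong succ (sym (opposite-involutive y)))
                                     (sym (step-tree t {opposite y} ty))))
                      (trans (inv (opposite y)) (X-opposite ty)))
        (λ ty → trans (cong X (sym (step-cotree t ty))) (inv y))
      p : Vertex → Bool
      p u = X (proj₁ (dart-at y u))
      at-src : ∀ {w u} → src w ≡ u → p u ≡ X w
      at-src {w} {u} eq = succ-invariant X X-succ (trans (proj₂ (dart-at y u)) (sym eq))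
      p-tree : ∀ x → t (edge x) ≡ true → p (src x) ≡ p (tgt x)
      p-tree x tx = trans (at-src refl) (trans (sym (X-opposite tx)) (sym (at-src refl)))

    abstract
      visits : ∀ d y → ∃[ k ] fold d τ k ≡ y
      visits = reaches τ-invariant-constant

    open Cycle _≟ᵈ_ visits public
    open Bounded code code-injective public

    module _ {d x : Dart} {s : Vertex → Bool} (side : IsSide t x s)
             (tx : t (edge x) ≡ true) (x<x* : pos d x ℕ.< pos d (opposite x)) where
      private
        x* = opposite x

        on-arc : ∀ {y z} → pos d y ℕ.≤ pos d z →
                 (∀ w → pos d y ℕ.≤ pos d w → pos d w ℕ.< pos d z → w ≢ x × w ≢ x*) →
                 s (src y) ≡ s (src z)
        on-arc le avoid = constant-on-arc (s ∘ src) d le λ w y≤w w<z →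
          let w≢x , w≢x* = avoid w y≤w w<z in side-τ side w≢x w≢x*

      side-before : ∀ {y} → pos d y ℕ.≤ pos d x → s (src y) ≡ false
      side-before y≤x = trans
        (on-arc y≤x λ w _ w<x →
          (λ { refl → ℕ.<-irrefl refl w<x }) ,
          (λ { refl → ℕ.<-asym w<x x<x* }))
        (near side)

      side-within : ∀ {y} → pos d x ℕ.< pos d y → pos d y ℕ.≤ pos d x* → s (src y) ≡ true
      side-within {y} x<y y≤x* = trans
        (sym (on-arc {τ x} {y} (ℕ.≤-trans (ℕ.≤-reflexive (pos-τ x<y)) x<y) λ w τx≤w w<y →
          (λ { refl → ℕ.<-irrefl (pos-τ x<y) (s≤s τx≤w) }) ,
          (λ { refl → ℕ.<-irrefl refl (ℕ.<-≤-trans w<y y≤x*) })))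
        (trans (cong s (τ-tree tx)) (far side))

      side-after : ∀ {y} → pos d x* ℕ.< pos d y → s (src y) ≡ false
      side-after {y} x*<y = trans
        (sym (on-arc {τ x*} {y} (ℕ.≤-trans (ℕ.≤-reflexive (pos-τ x*<y)) x*<y) λ w τx*≤w w<y →
          let x*<w = ℕ.≤-trans (ℕ.≤-reflexive (sym (pos-τ x*<y))) τx*≤w in
          (λ { refl → ℕ.<-asym x<x* x*<w }) ,
          (λ { refl → ℕ.<-irrefl refl x*<w })))
        (trans (cong s (trans (τ-tree {x*} tx) (tgt-opposite x))) (near side))

      side-true : ∀ {y} → s (src y) ≡ true → pos d x ℕ.< pos d y × pos d y ℕ.≤ pos d x*
      side-true sy =
        ℕ.≰⇒> (λ y≤x → true≢false sy (side-before y≤x)) ,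
        ℕ.≮⇒≥ (λ x*<y → true≢false sy (side-after x*<y))

      side-start : s (src d) ≡ false
      side-start = side-before (ℕ.≤-trans (ℕ.≤-reflexive (pos-start d)) z≤n)


  -- The orientation attached to a tour

  module BernardiTour (t : Edge → Bool) (tree : Tree t) (d : Dart) where
    open TreeTour t tree public
    open FirstDarts (pos d) pos-injective public

    q : Vertex
    q = src d

    -- Tree edges point away from q, and other edges towards their chip.
    orient : Edge → Bool
    orient e = t e xor first e

    orient-tree : ∀ {y} → t (edge y) ≡ true → pos d y ℕ.< pos d (opposite y) →
                  orient (edge y) ≡ not (proj₂ y)
    orient-tree ty lt = cong₂ _xor_ ty (first-unique lt)

    orient-cotree : ∀ {y} → t (edge y) ≡ false → pos d y ℕ.< pos d (opposite y) →
                    orient (edge y) ≡ proj₂ y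
    orient-cotree ty lt = cong₂ _xor_ ty (first-unique lt)

    precedes : ∀ y → pos d y ℕ.< pos d (opposite y) ⊎ pos d (opposite y) ℕ.< pos d y
    precedes y with ℕ.<-cmp (pos d y) (pos d (opposite y))
    ... | tri< lt _ _ = inj₁ lt
    ... | tri≈ _ eq _ = contradiction (sym (pos-injective eq)) opposite-≢
    ... | tri> _ _ gt = inj₂ gt

    previous : ∀ {y j} → pos d y ≡ suc j → ∃[ z ] pos d z ≡ j × τ z ≡ y
    previous {y} {j} eq = fold d τ j ,
      pos-at {d} {y} (ℕ.≤-trans (ℕ.n≤1+n j) (ℕ.≤-reflexive (sym eq))) ,
      trans (cong (fold d τ) (sym eq)) (at-pos d y)

    -- Induction on the time of the visit. The next dart starts at the same vertex, or at the head
    -- of a tree edge walked for the first time, along which `h` does not decrease, or, when an edge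
    -- is walked back, at the source of an earlier dart.
    orient-rooted : Rooted q orient
    orient-rooted h mono u =
      let y , eq = dart-at d u
      in  subst (λ v → h q ≤ h v) eq (upto (suc (pos d y)) y ℕ.≤-refl)
      where
      upto : ∀ k y → pos d y ℕ.< k → h q ≤ h (src y)
      upto (suc k) y (s≤s p≤k) with pos d y in p
      ... | zero = ℤ.≤-reflexive (cong (h ∘ src) (pos-injective (trans (pos-start d) (sym p))))
      ... | suc j with previous p
      ...   | z , pz , refl = bool-case (t (edge z)) tree-case λ tz →
                ℤ.≤-trans (upto k z z<k) (ℤ.≤-reflexive (cong h (sym (τ-cotree tz))))
        where
        z<k : pos d z ℕ.< k
        z<k = ℕ.≤-trans (s≤s (ℕ.≤-reflexive pz)) p≤k
        tree-case : t (edge z) ≡ true → h q ≤ h (src (τ z))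
        tree-case tz with precedes z
        ... | inj₁ z<z* = ℤ.≤-trans (upto k z z<k) (ℤ.≤-trans
                (ℤ.≤-reflexive (cong (λ b → h (src (edge z , b)))
                  (trans (sym (Bool.not-involutive (proj₂ z)))
                         (cong not (sym (orient-tree tz z<z*))))))
                (ℤ.≤-trans (mono (edge z)) (ℤ.≤-reflexive (cong h
                  (trans (cong (λ b → src (edge z , b)) (orient-tree tz z<z*)) (sym (τ-tree tz)))))))
        ... | inj₂ z*<z = ℤ.≤-trans (upto k (opposite z) (ℕ.<-trans z*<z z<k))
                (ℤ.≤-reflexive (cong h (sym (τ-tree tz))))

    -- Two different edges entering the same vertex would each lie on the far side of the other, and
    -- so each be walked later than the other.
    parent-edge-unique : ∀ {y z} → t (edge y) ≡ true → t (edge z) ≡ true →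
      pos d y ℕ.< pos d (opposite y) → pos d z ℕ.< pos d (opposite z) →
      tgt y ≡ tgt z → edge y ≡ edge z
    parent-edge-unique {y} {z} ty tz y<y* z<z* eq with edge y Fin.≟ edge z
    ... | yes e = e
    ... | no y≢z = contradiction (above ty tz y<y* z<z* eq (y≢z ∘ sym))
                                 (ℕ.<-asym (above tz ty z<z* y<y* (sym eq) y≢z))
      where
      above : ∀ {y z} → t (edge y) ≡ true → t (edge z) ≡ true →
        pos d y ℕ.< pos d (opposite y) → pos d z ℕ.< pos d (opposite z) →
        tgt y ≡ tgt z → edge z ≢ edge y → pos d y ℕ.< pos d z
      above {y} {z} ty tz y<y* z<z* eq z≢y with cut y ty
      ... | s , side = proj₁ (side-true side ty y<y* (trans (IsSide.uncrossed side z tz z≢y)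
                         (trans (cong s (sym eq)) (IsSide.far side))))

    root-has-no-parent : ∀ {y} → t (edge y) ≡ true → pos d y ℕ.< pos d (opposite y) → tgt y ≢ q
    root-has-no-parent {y} ty y<y* eq with cut y ty
    ... | s , side = true≢false (trans (cong s (sym eq)) (IsSide.far side)) (side-start side ty y<y*)

    -- The edge along which the tour first arrives at `u`. Its other dart starts at `u` and so is
    -- examined later, which makes the arriving dart the first of its edge.
    parent-edge : ∀ {u} → u ≢ q → ∃[ e ] t e ≡ true × src (e , not (first e)) ≡ u
    parent-edge {u} u≢q with dart-at d u
    ... | y₀ , eq₀ with least (λ k → src (fold d τ k) Fin.≟ u) (pos d y₀)
                              (trans (cong src (at-pos d y₀)) eq₀)
    ...   | zero  , eq , _   = contradiction (sym eq) u≢q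
    ...   | suc k , eq , min = bool-case (t (edge z))
      (λ tz → let tgt≡u = trans (sym (τ-tree tz)) eq in
        edge z , tz , trans (cong (λ b → src (edge z , not b)) (first-unique (earlier tgt≡u))) tgt≡u)
      (λ tz → contradiction (trans (sym (τ-cotree tz)) eq) (min k ℕ.≤-refl))
      where
      z = fold d τ k
      earlier : tgt z ≡ u → pos d z ℕ.< pos d (opposite z)
      earlier tgt≡u = ℕ.≤-trans (s≤s (pos-least refl)) (ℕ.≮⇒≥ λ lt →
        min (pos d (opposite z)) lt (trans (cong src (at-pos d _)) tgt≡u))

    tree-heads : Divisor graph
    tree-heads u = sum λ e → if t e then ⟨ src (e , not (first e)) ⟩ u else 0ℤ

    tree-heads-sum : ∀ u → tree-heads u ≡ 1ℤ - ⟨ q ⟩ u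
    tree-heads-sum u with u Fin.≟ q
    ... | yes refl = sum-zero λ e → bool-case (t e)
      (λ te → trans (if-true te)
                    (point-≢ λ eq → root-has-no-parent te (first-< e) (sym eq)))
      (λ te → if-false te)
    ... | no u≢q with parent-edge u≢q
    ...   | e , te , refl = trans
      (sum-single _ e λ f f≢e → bool-case (t f)
        (λ tf → trans (if-true tf)
          (point-≢ λ eq → f≢e (parent-edge-unique tf te (first-< f) (first-< e) (sym eq))))
        (λ tf → if-false tf))
      (trans (if-true te) (point-≡ {src (e , not (first e))} refl))

    bernardi : Divisor graph
    bernardi u = sum λ e → if t e then 0ℤ else ⟨ src (e , first e) ⟩ u

    indegree-orient : ∀ u → indegree orient u ≡ bernardi u + (1ℤ - ⟨ q ⟩ u)
    indegree-orient u = trans (ℤΣ.sum-cong-≗ split)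
      (trans (ℤΣ.∑-distrib-+ (λ e → if t e then 0ℤ else ⟨ src (e , first e) ⟩ u) _)
             (cong (bernardi u +_) (tree-heads-sum u)))
      where
      split : ∀ e → ⟨ src (e , orient e) ⟩ u ≡
        (if t e then 0ℤ else ⟨ src (e , first e) ⟩ u) + (if t e then ⟨ src (e , not (first e)) ⟩ u else 0ℤ)
      split e with t e
      ... | true  = sym (ℤ.+-identityˡ _)
      ... | false = sym (ℤ.+-identityʳ _)

  -- Recovering a tree from its indegrees

  FirstAt : (Edge → Bool) → Dart → ℕ → Dart → Set
  FirstAt t d j y = fold d (step t) j ≡ y ×
                    (∀ i → i ℕ.< j → edge (fold d (step t) i) ≢ edge y)

  AgreeUpTo : (Edge → Bool) → (Edge → Bool) → Dart → ℕ → Set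
  AgreeUpTo t t′ d k = ∀ j → j ℕ.< k → t (edge (fold d (step t) j)) ≡ t′ (edge (fold d (step t) j))

  AgreeUpTo-sym : ∀ {t t′ d k} → AgreeUpTo t t′ d k → AgreeUpTo t′ t d k
  AgreeUpTo-sym {t} {t′} {d} {k} agree j j<k =
    subst (λ y → t′ (edge y) ≡ t (edge y)) (fold-agree t t′ d k agree j (ℕ.<⇒≤ j<k)) (sym (agree j j<k))

  AgreeUpTo-≤ : ∀ {t t′ d j k} → j ℕ.≤ k → AgreeUpTo t t′ d k → AgreeUpTo t t′ d j
  AgreeUpTo-≤ j≤k agree i i<j = agree i (ℕ.<-≤-trans i<j j≤k)

  -- First visits are phrased with `step` instead of `pos` so that times and darts of a common past
  -- carry over from `t` to `t′` without comparing two tree structures.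
  FirstAt-agree : ∀ {t t′ d j y} → AgreeUpTo t t′ d j → FirstAt t d j y → FirstAt t′ d j y
  FirstAt-agree {t} {t′} {d} {j} agree (at , new) =
    trans (sym (fold-agree t t′ d j agree j ℕ.≤-refl)) at ,
    λ i i<j eq → new i i<j (trans (cong edge (fold-agree t t′ d j agree i (ℕ.<⇒≤ i<j))) eq)

  module FirstVisits (t : Edge → Bool) (tree : Tree t) (d : Dart) where
    open BernardiTour t tree d public

    FirstAt-pos : ∀ {j y} → FirstAt t d j y → pos d y ≡ j
    FirstAt-pos {j} {y} (at , new) = ℕ.≤-antisym (pos-least at)
      (ℕ.≮⇒≥ λ lt → new (pos d y) lt (cong edge (at-pos d y)))

    FirstAt-precedes : ∀ {j y} → FirstAt t d j y → pos d y ℕ.< pos d (opposite y)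
    FirstAt-precedes {j} {y} f@(at , new) with precedes y
    ... | inj₁ lt = lt
    ... | inj₂ gt = contradiction (cong edge (at-pos d (opposite y)))
      (new _ (ℕ.<-≤-trans gt (ℕ.≤-reflexive (FirstAt-pos f))))

    precedes-FirstAt : ∀ {y} → pos d y ℕ.< pos d (opposite y) → FirstAt t d (pos d y) y
    precedes-FirstAt {y} lt = at-pos d y , λ i i<p eq → case same-edge eq of λ
      { (inj₁ e) → ℕ.<-irrefl refl (ℕ.<-≤-trans i<p (pos-least e))
      ; (inj₂ e) → ℕ.<-asym lt (ℕ.≤-<-trans (pos-least e) i<p) }

    orient-tree-at : ∀ {j y} → FirstAt t d j y → t (edge y) ≡ true → orient (edge y) ≡ not (proj₂ y)
    orient-tree-at f ty = orient-tree ty (FirstAt-precedes f)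

    orient-cotree-at : ∀ {j y} → FirstAt t d j y → t (edge y) ≡ false → orient (edge y) ≡ proj₂ y
    orient-cotree-at f ty = orient-cotree ty (FirstAt-precedes f)

  module TwoTrees (t t′ : Edge → Bool) (tree : Tree t) (tree′ : Tree t′) (d : Dart) where
    module B  = FirstVisits t tree d
    module B′ = FirstVisits t′ tree′ d

    -- Let x be the first dart at which the tours differ.  Edges of O leaving
    -- the far side of x have been cut before x, so they are also oriented
    -- that way in O′; but x enters the far side in O and not in O′.
    first-difference : indegree B.orient ≗ indegree B′.orient →
      ∀ {k x} → FirstAt t d k x → AgreeUpTo t t′ d k →
      t (edge x) ≡ true → t′ (edge x) ≡ false → ⊥
    first-difference same-indegree {k} {x} fx agree tx t′x with B.cut x tx
    ... | s , side = true≢false {b = s (src x)}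
        (h-level (trans (ℤ.i-j≡0⇒i≡j _ _ (nonneg-sum-zero drop drop-nonneg drop-sum (edge x)))
            (trans (cong (λ b → h (src (edge x , b))) (B.orient-tree-at fx tx))
                   (h-far (IsSide.far side))))
          (cong (λ b → src (edge x , b)) (B′.orient-cotree-at (FirstAt-agree agree fx) t′x)))
        (IsSide.near side)
      where
      h : Vertex → ℤ
      h u = if s u then 0ℤ else 1ℤ
      h-far : ∀ {u} → s u ≡ true → h u ≡ 0ℤ
      h-far = if-true
      h-near : ∀ {u} → s u ≡ false → h u ≡ 1ℤ
      h-near = if-false
      h-level : ∀ {u v} → h u ≡ 0ℤ → u ≡ v → s v ≡ true
      h-level {u} hu refl = bool-case (s u) (λ e → e)
        λ e → contradiction (trans (sym (h-near e)) hu) λ ()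
      drop : Edge → ℤ
      drop e = h (src (e , B′.orient e)) - h (src (e , B.orient e))
      drop-sum : sum drop ≡ 0ℤ
      drop-sum = trans (sum-minus (λ e → h (src (e , B′.orient e))) (λ e → h (src (e , B.orient e))))
        (ℤ.i≡j⇒i-j≡0 (trans (sym (pairing-indegree h B′.orient))
          (trans (pairing-cong h (λ u → sym (same-indegree u))) (pairing-indegree h B.orient))))
      crossing : ∀ e → s (src (e , B.orient e)) ≡ false → s (src (e , B′.orient e)) ≡ true → ⊥
      crossing e near far = true≢false far (trans
        (cong (λ b → s (src (e , b))) (trans orient′≡ (sym orient≡))) near)
        where
        x<x* = B.FirstAt-precedes fx
        pos-x = B.FirstAt-pos fx
        orient-differs : B.orient e ≢ B′.orient e
        orient-differs eq = true≢false far (trans (cong (λ b → s (src (e , b))) (sym eq)) near)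
        e≢x : e ≢ edge x
        e≢x refl = true≢false far (trans
          (cong (λ b → s (src (edge x , b))) (B′.orient-cotree-at (FirstAt-agree agree fx) t′x))
          (IsSide.near side))
        te : t e ≡ false
        te = bool-case (t e)
          (λ te → ⊥-elim (true≢false far (trans (cong (λ b → s (src (e , b))) (Bool.¬-not (orient-differs ∘ sym)))
            (trans (sym (IsSide.uncrossed side (e , B.orient e) te e≢x)) near))))
          (λ te → te)
        y = (e , B.first e)
        orient≡ : B.orient e ≡ B.first e
        orient≡ = cong (_xor B.first e) te
        y<y* = B.first-< e
        y*-far : s (src (opposite y)) ≡ true
        y*-far = trans (cong (λ b → s (src (e , b)))
          (trans (cong not (sym orient≡)) (sym (Bool.¬-not (orient-differs ∘ sym))))) far
        y*-bounds = B.side-true side tx x<x* y*-far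
        -- `y` is on the near side, and `opposite y`, which comes later, on the far side. Were `y`
        -- after `x`, it would lie in the interval of the far side.
        y≤k : B.pos d y ℕ.≤ B.pos d x
        y≤k = ℕ.≮⇒≥ λ x<y → true≢false
          (B.side-within side tx x<x* x<y (ℕ.<⇒≤ (ℕ.<-≤-trans y<y* (proj₂ y*-bounds))))
          (trans (cong (λ b → s (src (e , b))) (sym orient≡)) near)
        y<k : B.pos d y ℕ.< k
        y<k = ℕ.<-≤-trans (ℕ.≤∧≢⇒< y≤k (e≢x ∘ cong edge ∘ B.pos-injective)) (ℕ.≤-reflexive pos-x)
        orient′≡ : B′.orient e ≡ B.first e
        orient′≡ = B′.orient-cotree-at
          (FirstAt-agree (AgreeUpTo-≤ {t} {t′} {d} (ℕ.<⇒≤ y<k) agree) (B.precedes-FirstAt y<y*))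
          (trans (sym (subst (λ z → t (edge z) ≡ t′ (edge z)) (B.at-pos d y) (agree (B.pos d y) y<k))) te)
      drop-nonneg : ∀ e → 0ℤ ≤ drop e
      drop-nonneg e = ℤ.i≤j⇒0≤j-i (bool-case (s (src (e , B.orient e)))
        (λ far → ℤ.≤-trans (ℤ.≤-reflexive (h-far far)) (h-nonneg (src (e , B′.orient e))))
        (λ near → ℤ.≤-reflexive (trans (h-near near)
          (sym (h-near {src (e , B′.orient e)} (Bool.¬-not (crossing e near)))))))
        where
        h-nonneg : ∀ u → 0ℤ ≤ h u
        h-nonneg u with s u
        ... | true  = ℤ.+≤+ z≤n
        ... | false = ℤ.+≤+ z≤n

  orient-injective : ∀ {t t′} (tree : Tree t) (tree′ : Tree t′) d →
    indegree (BernardiTour.orient t tree d) ≗ indegree (BernardiTour.orient t′ tree′ d) → t ≗ t′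
  orient-injective {t} {t′} tree tree′ d eq e with t e Bool.≟ t′ e
  ... | yes e≡ = e≡
  ... | no differ with least (λ k → Dec-differ (edge (fold d (step t) k))) (B.pos d (e , false))
                             (subst (λ y → t (edge y) ≢ t′ (edge y)) (sym (B.at-pos d (e , false))) differ)
    where
    module B = FirstVisits t tree d
    Dec-differ : ∀ e → Dec (t e ≢ t′ e)
    Dec-differ e = ¬? (t e Bool.≟ t′ e)
  ...   | k , differ-k , min = ⊥-elim (bool-case (t (edge x))
      (λ tx → TwoTrees.first-difference t t′ tree tree′ d eq fx agree tx
        (Bool.¬-not λ t′x → differ-k (trans tx (sym t′x))))
      (λ tx → TwoTrees.first-difference t′ t tree′ tree d (λ u → sym (eq u))
        (FirstAt-agree agree fx) (AgreeUpTo-sym {t} {t′} {d} agree)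
        (Bool.¬-not λ t′x → differ-k (trans tx (sym t′x))) tx))
    where
    x = fold d (step t) k
    agree : AgreeUpTo t t′ d k
    agree j j<k = decidable-stable (t _ Bool.≟ t′ _) (min j j<k)
    fx : FirstAt t d k x
    fx = refl , λ i i<k eq → min i i<k (λ e → differ-k (trans (sym (cong t eq)) (trans e (cong t′ eq))))

  -- Moving the start of the tour, and planarity

  arrow : Dart → Divisor graph
  arrow d u = ⟨ src d ⟩ u - ⟨ tgt d ⟩ u

  IsSide-opposite : ∀ {t x s} → IsSide t x s → IsSide t (opposite x) (not ∘ s)
  IsSide-opposite {x = x} {s} side = is-side
    (cong not (IsSide.far side))
    (cong not (trans (cong s (tgt-opposite x)) (IsSide.near side)))
    (λ y ty y≢x → cong not (IsSide.uncrossed side y ty y≢x))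

  module Shifts (t : Edge → Bool) (tree : Tree t) where
    open TreeTour t tree
    module B d = BernardiTour t tree d

    chip : Dart → Edge → Divisor graph
    chip d e u = if t e then 0ℤ else ⟨ src (e , B.first d e) ⟩ u

    bernardi-minus : ∀ d d′ u → B.bernardi d u - B.bernardi d′ u ≡ sum λ e → chip d e u - chip d′ e u
    bernardi-minus d d′ u = sym (sum-minus (λ e → chip d e u) (λ e → chip d′ e u))

    -- Moving the start to `d′` rotates the cyclic order: the darts of an edge change their order
    -- exactly when `d′` lies after the first and not after the second, which is the case of
    -- `split`.
    unsplit : ∀ d d′ {y} → pos d y ℕ.< pos d (opposite y) →
              pos d (opposite y) ℕ.< pos d d′ ⊎ pos d d′ ℕ.≤ pos d y →
              B.first d′ (edge y) ≡ B.first d (edge y)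
    unsplit d d′ y<y* (inj₁ y*<j) = trans (B.first-unique d′ (keeps-before d d′ y<y* y*<j))
                                          (sym (B.first-unique d y<y*))
    unsplit d d′ y<y* (inj₂ j≤y)  = trans (B.first-unique d′ (keeps-after d d′ j≤y y<y*))
                                          (sym (B.first-unique d y<y*))

    split : ∀ d d′ {y} → pos d y ℕ.< pos d d′ → pos d d′ ℕ.≤ pos d (opposite y) →
            B.first d′ (edge y) ≡ not (proj₂ y)
    split d d′ {y} y<j j≤y* = B.first-unique d′ (subst (λ z → pos d′ (opposite y) ℕ.< pos d′ z)
      (sym (opposite-involutive y)) (swaps d d′ y<j j≤y*))

    start-precedes : ∀ d → pos d d ℕ.< pos d (opposite d)
    start-precedes d with B.precedes d d
    ... | inj₁ lt = lt
    ... | inj₂ gt = contradiction (ℕ.<-≤-trans gt (ℕ.≤-reflexive (pos-start d))) λ ()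

    first-start : ∀ d → B.first d (edge d) ≡ proj₂ d
    first-start d = B.first-unique d (start-precedes d)

    pos-τ-start : ∀ d → pos d (τ d) ≡ 1
    pos-τ-start d = trans (pos-τ {d} {d} {opposite d} (start-precedes d)) (cong suc (pos-start d))

    first-τ : ∀ d e → e ≢ edge d → B.first (τ d) e ≡ B.first d e
    first-τ d e e≢d = unsplit d (τ d) {e , B.first d e} (B.first-< d e) (inj₂
      (ℕ.≤-trans (ℕ.≤-reflexive (pos-τ-start d)) (ℕ.n≢0⇒n>0 λ eq →
        e≢d (cong edge (pos-injective (trans eq (sym (pos-start d))))))))

    bernardi-τ : ∀ d → t (edge d) ≡ true → B.bernardi d ≗ B.bernardi (τ d)
    bernardi-τ d td u = ℤΣ.sum-cong-≗ λ e → bool-case (t e)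
      (λ te → trans (if-true te) (sym (if-true te)))
      (λ te → cong (λ b → if t e then 0ℤ else ⟨ src (e , b) ⟩ u)
        (sym (first-τ d e λ { refl → true≢false td te })))

    swapped-start : ∀ d d′ → t (edge d) ≡ false →
      (∀ e → e ≢ edge d → t e ≡ false → B.first d′ e ≡ B.first d e) →
      B.first d′ (edge d) ≡ not (proj₂ d) →
      B.bernardi d ≃ B.bernardi d′ ⊞ arrow d
    swapped-start d d′ td same swapped = ≃-reflexive λ u →
      let eq : B.bernardi d u - B.bernardi d′ u ≡ arrow d u
          eq = trans (bernardi-minus d d′ u) (trans
            (sum-single _ (edge d) λ e e≢d → ℤ.i≡j⇒i-j≡0 (bool-case (t e)
              (λ te → trans (if-true te) (sym (if-true te)))
              (λ te → cong (λ b → if t e then 0ℤ else ⟨ src (e , b) ⟩ u) (sym (same e e≢d te)))))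
            (cong₂ _-_
              (trans (if-false td) (cong (λ b → ⟨ src (edge d , b) ⟩ u) (first-start d)))
              (trans (if-false td) (cong (λ b → ⟨ src (edge d , b) ⟩ u) swapped))))
      in trans (lemma _ (B.bernardi d′ u)) (cong (B.bernardi d′ u +_) eq)
      where
      lemma : ∀ a b → a ≡ b + (a - b)
      lemma = solve-∀

    shift-cotree : ∀ d → t (edge d) ≡ false →
      B.bernardi d ≃ B.bernardi (τ d) ⊞ arrow d
    shift-cotree d td = swapped-start d (τ d) td (λ e e≢d _ → first-τ d e e≢d)
      (split d (τ d)
        (ℕ.≤-reflexive (trans (cong suc (pos-start d)) (sym (pos-τ-start d))))
        (ℕ.≤-trans (ℕ.≤-reflexive (trans (pos-τ-start d) (cong suc (sym (pos-start d)))))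
                   (start-precedes d)))

    -- Starting at d, the tour visits the far side of d before the near side;
    -- starting at succ d, it does the opposite.
    shift-tree : ∀ d → t (edge d) ≡ true →
      B.bernardi (τ d) ≃ B.bernardi (τ (opposite d)) ⊞ arrow d
    shift-tree d td with cut d td
    ... | s , side = ≃⁺ (f , λ u → trans (lemma (B.bernardi d₁ u) (B.bernardi d₂ u) (arrow d u))
        (trans (cong₂ _-_ (bernardi-minus d₁ d₂ u) (sym (only-d u)))
          (trans (sym (sum-minus (λ e → chip d₁ e u - chip d₂ e u) (at-d u)))
            (ℤΣ.sum-cong-≗ (per-edge u)))))
      where
      d₁ = τ d
      d₂ = τ (opposite d)
      f : Vertex → ℤ
      f v = if s v then 1ℤ else 0ℤ
      lemma : ∀ a b c → a - (b + c) ≡ (a - b) - c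
      lemma = solve-∀
      -- `edge d` crosses the cut but carries no chip, so its share of the Laplacian is supplied by
      -- `arrow d`.
      at-d : Vertex → Edge → ℤ
      at-d u e = if does (e Fin.≟ edge d) then arrow d u else 0ℤ
      only-d : ∀ u → sum (at-d u) ≡ arrow d u
      only-d u = trans (sum-single _ (edge d) λ e e≢d → if-false (dec-false (e Fin.≟ edge d) e≢d))
                       (if-true (dec-true (edge d Fin.≟ edge d) refl))
      d-last : ∀ y → pos d₁ y ℕ.≤ pos d₁ d
      d-last y = ℕ.≮⇒≥ λ lt → contradiction (trans (sym (pos-τ lt)) (pos-start d₁)) λ ()
      d*<d : pos d₁ (opposite d) ℕ.< pos d₁ d
      d*<d = ℕ.≤∧≢⇒< (d-last (opposite d)) (opposite-≢ ∘ pos-injective)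
      d*<d** : pos d₁ (opposite d) ℕ.< pos d₁ (opposite (opposite d))
      d*<d** = subst (λ z → pos d₁ (opposite d) ℕ.< pos d₁ z) (sym (opposite-involutive d)) d*<d
      j≡ : pos d₁ d₂ ≡ suc (pos d₁ (opposite d))
      j≡ = pos-τ d*<d
      far⇒before : ∀ {y} → s (src y) ≡ true → pos d₁ y ℕ.< pos d₁ d₂
      far⇒before {y} sy = ℕ.≤-trans (s≤s (ℕ.≮⇒≥ λ d*<y → true≢false
          (side-within (IsSide-opposite side) td d*<d** {y} d*<y
            (ℕ.≤-trans (d-last y) (ℕ.≤-reflexive (cong (pos d₁) (sym (opposite-involutive d))))))
          (cong not sy)))
        (ℕ.≤-reflexive (sym j≡))
      near⇒after : ∀ {y} → s (src y) ≡ false → pos d₁ d₂ ℕ.≤ pos d₁ y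
      near⇒after {y} sy = ℕ.≤-trans (ℕ.≤-reflexive j≡) (ℕ.≰⇒> λ y≤d* → true≢false
        (cong not sy)
        (side-before (IsSide-opposite side) td d*<d** {y} y≤d*))
      f-far : ∀ {v} → s v ≡ true → f v ≡ 1ℤ
      f-far = if-true
      f-near : ∀ {v} → s v ≡ false → f v ≡ 0ℤ
      f-near = if-false
      flat : ∀ u y → s (src y) ≡ s (tgt y) → edgeFlow graph f u (edge y) ≡ 0ℤ
      flat u y eq = trans (edgeFlow-point f u y) (trans
        (cong (_* (⟨ src y ⟩ u - ⟨ tgt y ⟩ u)) (ℤ.i≡j⇒i-j≡0 (cong (if_then 1ℤ else 0ℤ) eq)))
        (ℤ.*-zeroˡ (⟨ src y ⟩ u - ⟨ tgt y ⟩ u)))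
      per-edge : ∀ u e → (chip d₁ e u - chip d₂ e u) - at-d u e ≡ edgeFlow graph f u e
      per-edge u e = bool-case (t e) tree-edge cotree-edge
        where
        tree-edge : t e ≡ true → (chip d₁ e u - chip d₂ e u) - at-d u e ≡ edgeFlow graph f u e
        tree-edge te with e Fin.≟ edge d
        ... | yes refl = trans (cong (_- arrow d u) (cong₂ _-_ (if-true te) (if-true te)))
          (trans (neg (⟨ src d ⟩ u) (⟨ tgt d ⟩ u)) (sym (trans (edgeFlow-point f u d)
            (cong (_* arrow d u) (cong₂ _-_ (f-near (IsSide.near side)) (f-far (IsSide.far side)))))))
          where
          neg : ∀ a b → (0ℤ - 0ℤ) - (a - b) ≡ (0ℤ - 1ℤ) * (a - b)
          neg = solve-∀
        ... | no e≢d = trans (cong (_- 0ℤ) (cong₂ _-_ (if-true te) (if-true te)))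
          (sym (flat u (e , true) (IsSide.uncrossed side (e , true) te e≢d)))
        cotree-edge : t e ≡ false → (chip d₁ e u - chip d₂ e u) - at-d u e ≡ edgeFlow graph f u e
        cotree-edge te = trans
          (trans (cong₂ _-_ (cong₂ _-_ (if-false te) (if-false te))
                   (if-false (dec-false (e Fin.≟ edge d) λ { refl → true≢false td te })))
                 (ℤ.+-identityʳ _))
          (bool-case (s (src y))
            (λ sy → bool-case (s (tgt y))
              (λ sy* → unchanged (inj₁ (far⇒before sy*)) (trans sy (sym sy*)))
              (λ sy* → trans (cong (λ b → ⟨ src y ⟩ u - ⟨ src (e , b) ⟩ u)
                               (split d₁ d₂ {y} (far⇒before sy) (near⇒after sy*)))
                (sym (trans (edgeFlow-point f u y)
                  (trans (cong (_* (⟨ src y ⟩ u - ⟨ tgt y ⟩ u)) (cong₂ _-_ (f-far sy) (f-near sy*)))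
                         (ℤ.*-identityˡ (⟨ src y ⟩ u - ⟨ tgt y ⟩ u)))))))
            (λ sy → bool-case (s (tgt y))
              (λ sy* → contradiction (near⇒after {y} sy)
                (ℕ.<⇒≱ (ℕ.<-trans (B.first-< d₁ e) (far⇒before sy*))))
              (λ sy* → unchanged (inj₂ (near⇒after sy)) (trans sy (sym sy*)))))
          where
          y = (e , B.first d₁ e)
          unchanged : pos d₁ (opposite y) ℕ.< pos d₁ d₂ ⊎ pos d₁ d₂ ℕ.≤ pos d₁ y →
                      s (src y) ≡ s (tgt y) →
                      ⟨ src y ⟩ u - ⟨ src (e , B.first d₂ e) ⟩ u ≡ edgeFlow graph f u e
          unchanged where-j eq = trans
            (ℤ.i≡j⇒i-j≡0 (cong (λ b → ⟨ src (e , b) ⟩ u) (sym (unsplit d₁ d₂ {y} (B.first-< d₁ e) where-j))))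
            (sym (flat u y eq))

    shift-succ : ∀ d → B.bernardi d ≃ B.bernardi (succ d) ⊞ arrow d
    shift-succ d = bool-case (t (edge d))
      (λ td → ≃-trans (≃-reflexive (bernardi-τ d td))
        (subst (λ z → B.bernardi (τ d) ≃ B.bernardi z ⊞ arrow d)
          (trans (step-tree t {opposite d} td) (cong succ (opposite-involutive d)))
          (shift-tree d td)))
      (λ td → subst (λ z → B.bernardi d ≃ B.bernardi z ⊞ arrow d)
          (step-cotree t td) (shift-cotree d td))

    -- As d has position 0, this says that the darts of the two edges alternate.
    Interlaced : Dart → Dart → Set
    Interlaced d y = pos d y ℕ.< pos d (opposite d) × pos d (opposite d) ℕ.≤ pos d (opposite y)

    -- For a tree edge, `τ d` is the successor of `opposite d`, and `shift-succ` applies to the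
    -- latter, with `arrow` changing sign. For a cotree edge, the start moves past exactly one dart
    -- of `d` itself and of each edge interlaced with it, so without interlacing only the chip of
    -- `d` moves.
    shift-opposite : (∀ d y → t (edge d) ≡ false → t (edge y) ≡ false → edge y ≢ edge d →
                        ¬ Interlaced d y) →
      ∀ d → B.bernardi d ≃ B.bernardi (opposite d) ⊞ arrow d
    shift-opposite planar d = bool-case (t (edge d)) tree-edge cotree-edge
      where
      tree-edge : t (edge d) ≡ true → _
      tree-edge td = ≃-trans (≃-reflexive (bernardi-τ d td))
        (≃-trans (≃-reflexive λ u → moved u)
          (≃-⊞ (≃-sym succ-step) (≃-reflexive {arrow d} λ _ → refl)))
        where
        d* = opposite d
        succ-step : B.bernardi d* ≃ B.bernardi (succ d*) ⊞ arrow d*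
        succ-step = shift-succ d*
        cancel : ∀ c a b → c ≡ (c + (a - b)) + (b - a)
        cancel = solve-∀
        moved : ∀ u → B.bernardi (τ d) u ≡ (B.bernardi (succ d*) u + arrow d* u) + arrow d u
        moved u = trans (cong (λ z → B.bernardi z u) (step-tree t td))
          (trans (cancel (B.bernardi (succ d*) u) (⟨ tgt d ⟩ u) (⟨ src d ⟩ u))
            (cong (λ v → (B.bernardi (succ d*) u + (⟨ tgt d ⟩ u - ⟨ v ⟩ u)) + arrow d u)
              (sym (tgt-opposite d))))
      cotree-edge : t (edge d) ≡ false → _
      cotree-edge td = swapped-start d (opposite d) td
        (λ e e≢d te → let y = (e , B.first d e) in
          unsplit d (opposite d) {y} (B.first-< d e)
            (case pos d (opposite d) ℕ.≤? pos d y of λ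
              { (yes le) → inj₂ le
              ; (no ¬le) → case pos d (opposite d) ℕ.≤? pos d (opposite y) of λ
                { (yes le) → contradiction (ℕ.≰⇒> ¬le , le) (planar d y td te e≢d)
                ; (no ¬le′) → inj₁ (ℕ.≰⇒> ¬le′) } }))
        (first-start (opposite d))

  -- If edges d and y outside t interlaced, then adding both of them to t
  -- would give a tour with one cycle, so already the cotree edges other than these
  -- two would connect the faces; this is too few edges by Euler's formula.
  module _ (planar : Planar R) (t : Edge → Bool) (tree : Tree t) where
    open TreeTour t tree
    open Shifts t tree using (Interlaced; pos-τ-start)

    private
      c = proj₁ (proj₁ (proj₂ planar))
      c-surjective = proj₁ (proj₂ (proj₁ (proj₂ planar)))
      c-orbits = proj₂ (proj₂ (proj₁ (proj₂ planar)))
      euler = proj₂ (proj₂ planar)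

      c-face : ∀ z → c (faceStep R z) ≡ c z
      c-face z = sym (Equivalence.from (c-orbits z (faceStep R z)) (1 , refl))

      c-succ : ∀ z → c (succ z) ≡ c (opposite z)
      c-succ z = trans (cong (c ∘ succ) (sym (opposite-involutive z))) (c-face (opposite z))

    -- The four darts come in the order `d`, `y`, `d*`, `y*`. `X` is constant on the arcs between
    -- them, and `switch` glues the arcs together out of order, which gives the same value to `y`,
    -- `d*`, `y*` and `d`. Then `opposite` preserves `X` on both edges, and `switch` turns into
    -- invariance under `τ`.
    interlaced-constant : ∀ {d y} → t (edge d) ≡ false → t (edge y) ≡ false → edge y ≢ edge d →
      Interlaced d y → (X : Dart → Bool) →
      (∀ z → edge z ≢ edge d → edge z ≢ edge y → X (τ z) ≡ X z) →
      (∀ z → edge z ≡ edge d ⊎ edge z ≡ edge y → X (τ z) ≡ X (opposite z)) →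
      ∀ z w → X z ≡ X w
    interlaced-constant {d} {y} td ty y≢d (y<d* , d*≤y*) X same switch = τ-invariant-constant X invariant
      where
      d* = opposite d
      y* = opposite y
      d*<y* : pos d d* ℕ.< pos d y*
      d*<y* = ℕ.≤∧≢⇒< d*≤y* λ eq → y≢d (sym (cong edge (pos-injective eq)))
      d<y : 0 ℕ.< pos d y
      d<y = ℕ.n≢0⇒n>0 λ eq → y≢d (cong edge (pos-injective (trans eq (sym (pos-start d)))))
      away : ∀ {w} → w ≢ d → w ≢ d* → w ≢ y → w ≢ y* → X (τ w) ≡ X w
      away {w} w≢d w≢d* w≢y w≢y* = same w
        (λ e → case same-edge {d} {w} e of λ { (inj₁ e) → w≢d e ; (inj₂ e) → w≢d* e })
        (λ e → case same-edge {y} {w} e of λ { (inj₁ e) → w≢y e ; (inj₂ e) → w≢y* e })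
      before : ∀ {w z} → pos d w ℕ.< pos d z → w ≢ z
      before lt refl = ℕ.<-irrefl refl lt
      after : ∀ {w z} → pos d z ℕ.< pos d w → w ≢ z
      after lt refl = ℕ.<-irrefl refl lt
      arc₁ : X (τ d) ≡ X y
      arc₁ = constant-on-arc X d (ℕ.≤-trans (ℕ.≤-reflexive (pos-τ-start d)) d<y) λ w τd≤w w<y → away
        (after (ℕ.≤-trans (ℕ.≤-reflexive (trans (cong suc (pos-start d)) (sym (pos-τ-start d)))) τd≤w))
        (before (ℕ.<-trans w<y y<d*))
        (before w<y)
        (before (ℕ.<-trans w<y (ℕ.<-trans y<d* d*<y*)))
      arc₂ : X (τ y) ≡ X d*
      arc₂ = constant-on-arc X d (ℕ.≤-trans (ℕ.≤-reflexive (pos-τ y<d*)) y<d*) λ w τy≤w w<d* →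
        let y<w = ℕ.≤-trans (ℕ.≤-reflexive (sym (pos-τ y<d*))) τy≤w in away
        (after (ℕ.≤-<-trans (ℕ.≤-reflexive (pos-start d)) (ℕ.<-trans d<y y<w)))
        (before w<d*)
        (after y<w)
        (before (ℕ.<-trans w<d* d*<y*))
      arc₃ : X (τ d*) ≡ X y*
      arc₃ = constant-on-arc X d (ℕ.≤-trans (ℕ.≤-reflexive (pos-τ d*<y*)) d*<y*) λ w τd*≤w w<y* →
        let d*<w = ℕ.≤-trans (ℕ.≤-reflexive (sym (pos-τ d*<y*))) τd*≤w in away
        (after (ℕ.≤-<-trans (ℕ.≤-reflexive (pos-start d)) (ℕ.<-trans d<y (ℕ.<-trans y<d* d*<w))))
        (after d*<w)
        (after (ℕ.<-trans y<d* d*<w))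
        (before w<y*)
      y≡d* : X y ≡ X d*
      y≡d* = trans (sym arc₁) (switch d (inj₁ refl))
      d*≡y* : X d* ≡ X y*
      d*≡y* = trans (sym arc₂) (switch y (inj₂ refl))
      y*≡d : X y* ≡ X d
      y*≡d = trans (sym arc₃) (trans (switch d* (inj₁ refl)) (cong X (opposite-involutive d)))
      flip-d : ∀ z → edge z ≡ edge d → X (opposite z) ≡ X z
      flip-d z e with same-edge {d} {z} e
      ... | inj₁ refl = trans d*≡y* y*≡d
      ... | inj₂ refl = trans (cong X (opposite-involutive d)) (sym (trans d*≡y* y*≡d))
      flip-y : ∀ z → edge z ≡ edge y → X (opposite z) ≡ X z
      flip-y z e with same-edge {y} {z} e
      ... | inj₁ refl = sym (trans y≡d* d*≡y*)
      ... | inj₂ refl = trans (cong X (opposite-involutive y)) (trans y≡d* d*≡y*)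
      invariant : ∀ z → X (τ z) ≡ X z
      invariant z with edge z Fin.≟ edge d | edge z Fin.≟ edge y
      ... | yes e | _     = trans (switch z (inj₁ e)) (flip-d z e)
      ... | no _  | yes e = trans (switch z (inj₂ e)) (flip-y z e)
      ... | no e  | no e′ = same z e e′

    tree-count : n ℕ.≤ suc (count t)
    tree-count = connected-count (λ e → src (e , false) , src (e , true)) t λ p inv →
      joins p λ { (e , false) te → inv e te ; (e , true) te → sym (inv e te) }

    no-interlacing : ∀ d y → t (edge d) ≡ false → t (edge y) ≡ false → edge y ≢ edge d →
                     ¬ Interlaced d y
    no-interlacing d y td ty y≢d interlaced = ℕ.<-irrefl refl (begin-strict
      m                                        <⟨ ℕ.m<m+n m (s≤s z≤n) ⟩
      m ℕ.+ 2                                  ≡⟨ euler ⟨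
      n ℕ.+ (proj₁ planar ℕ.⊔ 1) ℕ.+ 0         ≡⟨ ℕ.+-identityʳ _ ⟩
      n ℕ.+ (proj₁ planar ℕ.⊔ 1)               ≤⟨ ℕ.+-mono-≤ tree-count (ℕ.⊔-lub faces-count (s≤s z≤n)) ⟩
      suc (count t) ℕ.+ suc (count rest)       ≡⟨ ℕ.+-suc (count t) (suc (count rest)) ⟨
      count t ℕ.+ suc (suc (count rest))       ≡⟨ cong (count t ℕ.+_) rest-count ⟩
      count t ℕ.+ count (not ∘ t)              ≡⟨ count-not t ⟩
      m                                        ∎)
      where
      open ℕ.≤-Reasoning
      others rest : Edge → Bool
      others = updateAt (not ∘ t) (edge d) (const false)
      rest = updateAt others (edge y) (const false)
      rest-true : ∀ e → t e ≡ false → e ≢ edge d → e ≢ edge y → rest e ≡ true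
      rest-true e te e≢d e≢y = trans (updateAt-minimal e (edge y) others e≢y)
        (trans (updateAt-minimal e (edge d) (not ∘ t) e≢d) (cong not te))
      rest-count : suc (suc (count rest)) ≡ count (not ∘ t)
      rest-count = trans
        (cong suc (count-remove others (edge y)
          (trans (updateAt-minimal (edge y) (edge d) (not ∘ t) y≢d) (cong not ty))))
        (count-remove (not ∘ t) (edge d) (cong not td))
      faces-count : proj₁ planar ℕ.≤ suc (count rest)
      -- A cocycle on the dual graph, where an edge joins the faces of its two darts, pulls back
      -- along `c` to the darts. There `τ` is the face permutation on tree darts and leads to the
      -- face of the opposite dart on cotree darts.
      faces-count = connected-count (λ e → c (e , false) , c (e , true)) rest λ p inv i j →
        let X = p ∘ c
            across : ∀ z → rest (edge z) ≡ true → X (opposite z) ≡ X z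
            across = λ { (e , false) r → sym (inv e r) ; (e , true) r → inv e r }
            same : ∀ z → edge z ≢ edge d → edge z ≢ edge y → X (τ z) ≡ X z
            same z z≢d z≢y = bool-case (t (edge z))
              (λ tz → trans (cong X (step-tree t tz)) (cong p (c-face z)))
              (λ tz → trans (cong X (step-cotree t tz)) (trans (cong p (c-succ z))
                        (across z (rest-true (edge z) tz z≢d z≢y))))
            switch : ∀ z → edge z ≡ edge d ⊎ edge z ≡ edge y → X (τ z) ≡ X (opposite z)
            switch z e = trans (cong X (step-cotree t (case e of λ
              { (inj₁ e) → trans (cong t e) td ; (inj₂ e) → trans (cong t e) ty }))) (cong p (c-succ z))
            xi , ei = c-surjective i
            xj , ej = c-surjective j
        in  trans (cong p (sym ei))
              (trans (interlaced-constant {d} {y} td ty y≢d interlaced X same switch xi xj)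
                     (cong p ej))

  -- Exchanges and paths in trees

  exchange : (Edge → Bool) → Edge → Edge → (Edge → Bool)
  exchange t f e g = if does (g Fin.≟ e) then true else if does (g Fin.≟ f) then false else t g

  exchange-new : ∀ t f e → exchange t f e e ≡ true
  exchange-new t f e = if-true (dec-true (e Fin.≟ e) refl)

  exchange-old : ∀ t f e → f ≢ e → exchange t f e f ≡ false
  exchange-old t f e f≢e = trans (if-false (dec-false (f Fin.≟ e) f≢e)) (if-true (dec-true (f Fin.≟ f) refl))

  exchange-other : ∀ t f e {g} → g ≢ f → g ≢ e → exchange t f e g ≡ t g
  exchange-other t f e {g} g≢f g≢e =
    trans (if-false (dec-false (g Fin.≟ e) g≢e)) (if-false (dec-false (g Fin.≟ f) g≢f))

  exchange-true : ∀ t f e {g} → exchange t f e g ≡ true → g ≡ e ⊎ t g ≡ true × g ≢ f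
  exchange-true t f e {g} eq with g Fin.≟ e | g Fin.≟ f
  ... | yes g≡e | _     = inj₁ g≡e
  ... | no _    | no g≢f = inj₂ (eq , g≢f)

  -- Adding `s (src z)` swaps the two sides if necessary, since `IsSide` wants `src z` on the side
  -- `false`.
  separating-side : ∀ {t z} (s : Vertex → Bool) → s (src z) ≢ s (tgt z) →
    (∀ w → t (edge w) ≡ true → edge w ≢ edge z → s (src w) ≡ s (tgt w)) →
    IsSide t z (λ u → s (src z) xor s u)
  separating-side {z = z} s neq same = is-side (Bool.xor-same (s (src z))) (xor-≢ neq)
    λ w tw w≢z → cong (s (src z) xor_) (same w tw w≢z)

  -- Each side of the cut of `x` is still joined by the remaining edges, and `y` joins the two
  -- sides. As fundamental cut, `y` inherits that of `x`; any other edge keeps its own or, if `y`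
  -- crosses it, takes its symmetric difference with the cut of `x`.
  exchange-tree : ∀ {t} → Tree t → ∀ {x y s} → t (edge x) ≡ true → IsSide t x s →
                  s (src y) ≢ s (tgt y) → Tree (exchange t (edge x) (edge y))
  exchange-tree {t} tree {x} {y} {s} tx side crosses = record { joins = joins′ ; cut = cut′ }
    where
    open Tree tree
    t′ = exchange t (edge x) (edge y)

    transfer : ∀ {A : Set} (p : Vertex → A) z → edge z ≡ edge y → p (src y) ≡ p (tgt y) → p (src z) ≡ p (tgt z)
    transfer p z e eq with same-edge {y} {z} e
    ... | inj₁ refl = eq
    ... | inj₂ refl = trans (sym eq) (cong p (sym (tgt-opposite y)))

    transfer-back : ∀ z → edge z ≡ edge y → s (src z) ≡ s (tgt z) → s (src y) ≡ s (tgt y)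
    transfer-back z e eq with same-edge {y} {z} e
    ... | inj₁ refl = eq
    ... | inj₂ refl = trans (cong s (sym (tgt-opposite y))) (sym eq)

    joins′ : ∀ (p : Vertex → Bool) → (∀ z → t′ (edge z) ≡ true → p (src z) ≡ p (tgt z)) → ∀ u w → p u ≡ p w
    joins′ p inv u w = trans (to-base u) (sym (to-base w))
      where
      base : Bool → Vertex
      base b = if b then tgt x else src x
      -- On the other side, `p` is replaced by its value at the end of `x` in the side `b`. So `r b`
      -- is constant along `x` even though `x` is gone, and `joins` for the old tree applies.
      r : Bool → Vertex → Bool
      r b v = if does (s v Bool.≟ b) then p v else p (base b)
      r-here : ∀ {b v} → s v ≡ b → r b v ≡ p v
      r-here {b} {v} e = if-true (dec-true (s v Bool.≟ b) e)
      r-there : ∀ {b v} → s v ≢ b → r b v ≡ p (base b)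
      r-there {b} {v} e = if-false (dec-false (s v Bool.≟ b) e)
      r-x : ∀ b → r b (src x) ≡ r b (tgt x)
      r-x false = trans (r-here (IsSide.near side)) (sym (r-there λ e → true≢false (IsSide.far side) e))
      r-x true  = trans (r-there λ e → true≢false e (IsSide.near side)) (sym (r-here (IsSide.far side)))
      inv-old : ∀ z → t (edge z) ≡ true → edge z ≢ edge x → p (src z) ≡ p (tgt z)
      inv-old z tz z≢x with edge z Fin.≟ edge y
      ... | yes e = inv z (trans (cong t′ e) (exchange-new t (edge x) (edge y)))
      ... | no z≢y = inv z (trans (exchange-other t (edge x) (edge y) z≢x z≢y) tz)
      r-inv : ∀ b z → t (edge z) ≡ true → r b (src z) ≡ r b (tgt z)
      r-inv b z tz with edge z Fin.≟ edge x
      ... | no z≢x = cong₂ (λ c a → if does (c Bool.≟ b) then a else p (base b))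
                           (IsSide.uncrossed side z tz z≢x) (inv-old z tz z≢x)
      ... | yes e with same-edge {x} {z} e
      ...   | inj₁ refl = r-x b
      ...   | inj₂ refl = trans (sym (r-x b)) (cong (r b) (sym (tgt-opposite x)))
      base-side : ∀ b → s (base b) ≡ b
      base-side false = IsSide.near side
      base-side true  = IsSide.far side
      p-side : ∀ v → p v ≡ p (base (s v))
      p-side v = trans (sym (r-here {s v} {v} refl)) (trans
        (joins (r (s v)) (r-inv (s v)) v (base (s v))) (r-here (base-side (s v))))
      p-y : p (base (s (src y))) ≡ p (base (s (tgt y)))
      p-y = trans (sym (p-side (src y))) (trans
        (inv y (exchange-new t (edge x) (edge y))) (p-side (tgt y)))
      to-base : ∀ v → p v ≡ p (base (s (src y)))
      to-base v with s v Bool.≟ s (src y)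
      ... | yes e = trans (p-side v) (cong (p ∘ base) e)
      ... | no ¬e = trans (p-side v) (trans (cong (p ∘ base)
        (trans (Bool.¬-not ¬e) (sym (Bool.¬-not (crosses ∘ sym))))) (sym p-y))

    cut′ : ∀ z → t′ (edge z) ≡ true → ∃[ s′ ] IsSide t′ z s′
    cut′ z t′z with exchange-true t (edge x) (edge y) t′z
    ... | inj₁ z≡y = (λ u → s (src z) xor s u) , separating-side s
      (λ eq → crosses (transfer-back z z≡y eq))
      λ w t′w w≢z → case exchange-true t (edge x) (edge y) t′w of λ
        { (inj₁ w≡y) → contradiction (trans w≡y (sym z≡y)) w≢z
        ; (inj₂ (tw , w≢x)) → IsSide.uncrossed side w tw w≢x }
    ... | inj₂ (tz , z≢x) with cut z tz
    ...   | s₁ , side₁ with s₁ (src y) Bool.≟ s₁ (tgt y)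
    ...     | yes eq = s₁ , is-side (IsSide.near side₁) (IsSide.far side₁)
      λ w t′w w≢z → case exchange-true t (edge x) (edge y) t′w of λ
        { (inj₁ w≡y) → transfer s₁ w w≡y eq
        ; (inj₂ (tw , w≢x)) → IsSide.uncrossed side₁ w tw w≢z }
    ...     | no neq = _ , separating-side (λ u → s₁ u xor s u)
      (λ eq → true≢false (IsSide.far side₁) (trans
        (xor-cancelʳ (s (tgt z)) (trans (sym eq) (cong (s₁ (src z) xor_) (IsSide.uncrossed side z tz z≢x)))) (IsSide.near side₁)))
      λ w t′w w≢z → case exchange-true t (edge x) (edge y) t′w of λ
        { (inj₁ w≡y) → transfer (λ u → s₁ u xor s u) w w≡y
            (trans (cong₂ _xor_ (Bool.¬-not neq) (Bool.¬-not crosses)) (xor-not (s₁ (tgt y)) (s (tgt y))))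
        ; (inj₂ (tw , w≢x)) → cong₂ _xor_ (IsSide.uncrossed side₁ w tw w≢z)
                                          (IsSide.uncrossed side w tw w≢x) }
      where
      xor-not : ∀ a b → not a xor not b ≡ a xor b
      xor-not true  true  = refl
      xor-not true  false = refl
      xor-not false true  = refl
      xor-not false false = refl

  module TreePaths (t : Edge → Bool) (tree : Tree t) (d : Dart) where
    open FirstVisits t tree d public

    first-dart : Edge → Dart
    first-dart f = f , first f

    abstract
      private
        choose-side : ∀ f → ∃[ s ] (t f ≡ true → IsSide t (first-dart f) s)
        choose-side f = bool-case (t f)
          (λ tf → let s , side = cut (first-dart f) tf in s , λ _ → side)
          -- An edge outside `t` has no fundamental cut; `on-path` and `separates` mask the default
          -- by testing `t f`.
          (λ tf → const false , λ tf′ → ⊥-elim (true≢false tf′ tf))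

      far-side : Edge → Vertex → Bool
      far-side f = proj₁ (choose-side f)

      far-side-isSide : ∀ {f} → t f ≡ true → IsSide t (first-dart f) (far-side f)
      far-side-isSide {f} = proj₂ (choose-side f)

    -- The edge f contributes its boundary to the path from q to u in t.
    on-path : Vertex → Edge → Divisor graph
    on-path u f w = if t f then (if far-side f u then ⟨ tgt (first-dart f) ⟩ w - ⟨ src (first-dart f) ⟩ w else 0ℤ) else 0ℤ

    on-path-true : ∀ {u f} w → t f ≡ true → far-side f u ≡ true →
      on-path u f w ≡ ⟨ tgt (first-dart f) ⟩ w - ⟨ src (first-dart f) ⟩ w
    on-path-true w tf sf = trans (if-true tf) (if-true sf)

    on-path-false : ∀ {u f} w → t f ≡ true → far-side f u ≡ false → on-path u f w ≡ 0ℤ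
    on-path-false w tf sf = trans (if-true tf) (if-false sf)

    path : Vertex → Divisor graph
    path u w = sum λ f → on-path u f w

    -- The boundary of the path from `v` to `u`. The difference of `path u` and `⟨ u ⟩` does not
    -- depend on `u`: between the ends of a tree edge only the summand of that edge changes, as no
    -- other fundamental cut separates them.
    path-minus : ∀ u v w → path u w - path v w ≡ ⟨ u ⟩ w - ⟨ v ⟩ w
    path-minus u v w = rearrange (path u w) (path v w) (⟨ u ⟩ w) (⟨ v ⟩ w)
      (constant ℤ._≟_ (λ u → path u w - ⟨ u ⟩ w) invariant u v)
      where
      rearrange : ∀ a b c e → a - c ≡ b - e → a - b ≡ c - e
      rearrange a b c e eq = trans (lemma₁ a b c) (trans (cong (λ x → x + c - b) eq) (lemma₂ b c e))
        where
        lemma₁ : ∀ a b c → a - b ≡ (a - c) + c - b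
        lemma₁ = solve-∀
        lemma₂ : ∀ b c e → (b - e) + c - b ≡ c - e
        lemma₂ = solve-∀
      along-edge : ∀ f → t f ≡ true →
        path (src (first-dart f)) w - ⟨ src (first-dart f) ⟩ w ≡
        path (tgt (first-dart f)) w - ⟨ tgt (first-dart f) ⟩ w
      along-edge f tf = sym (rearrange (path (tgt z) w) (⟨ tgt z ⟩ w) (path (src z) w) (⟨ src z ⟩ w)
        (trans (sym (sum-minus (λ g → on-path (tgt z) g w) (λ g → on-path (src z) g w)))
          (trans (sum-single _ f λ g g≢f → bool-case (t g)
                    (λ tg → ℤ.i≡j⇒i-j≡0 (cong (λ b → if t g then (if b then _ else 0ℤ) else 0ℤ)
                        (sym (IsSide.uncrossed (far-side-isSide tg) z tf (g≢f ∘ sym)))))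
                    (λ tg → cong₂ _-_ (if-false tg) (if-false tg)))
            (trans (cong₂ _-_ (on-path-true w tf (IsSide.far (far-side-isSide tf)))
                              (on-path-false w tf (IsSide.near (far-side-isSide tf))))
                   (ℤ.+-identityʳ _)))))
        where
        z = first-dart f
      invariant : ∀ y → t (edge y) ≡ true → path (src y) w - ⟨ src y ⟩ w ≡ path (tgt y) w - ⟨ tgt y ⟩ w
      invariant y ty with same-edge {first-dart (edge y)} {y} refl
      ... | inj₁ eq = subst (λ z → path (src z) w - ⟨ src z ⟩ w ≡ path (tgt z) w - ⟨ tgt z ⟩ w)
                            (sym eq) (along-edge (edge y) ty)
      ... | inj₂ eq = subst (λ z → path (src z) w - ⟨ src z ⟩ w ≡ path (tgt z) w - ⟨ tgt z ⟩ w)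
        (sym eq) (trans (sym (along-edge (edge y) ty))
          (cong (λ v → path v w - ⟨ v ⟩ w) (sym (tgt-opposite (first-dart (edge y))))))

    separates : Vertex → Vertex → Edge → Bool
    separates a b f = t f ∧ (far-side f a xor far-side f b)

    separates⇒tree : ∀ {a b f} → separates a b f ≡ true → t f ≡ true
    separates⇒tree {f = f} eq with t f
    ... | true = refl

    separates⇒≢ : ∀ {a b f} → separates a b f ≡ true → far-side f a ≢ far-side f b
    separates⇒≢ {f = f} eq with t f
    ... | true = xor-true eq

    -- By `downwards`, `a` lies beyond every tree edge between `a` and `b`, so `O` directs the path
    -- from `b` to `a`. Its reversal moves one unit of indegree from the last vertex to the first.
    indegree-reverse-path : ∀ a b O →
      (∀ f → separates a b f ≡ true → far-side f a ≡ true × O f ≡ not (first f)) →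
      ∀ u → indegree (λ f → O f xor separates a b f) u ≡ indegree O u - (⟨ a ⟩ u - ⟨ b ⟩ u)
    indegree-reverse-path a b O downwards u = begin
      indegree O′ u                                     ≡⟨ split (indegree O u) (indegree O′ u) ⟩
      indegree O u - (indegree O u - indegree O′ u)     ≡⟨ cong (λ x → indegree O u - x) (begin
        indegree O u - indegree O′ u                      ≡⟨ sum-minus (λ f → ⟨ src (f , O f) ⟩ u) (λ f → ⟨ src (f , O′ f) ⟩ u) ⟨
        sum (λ f → ⟨ src (f , O f) ⟩ u - ⟨ src (f , O′ f) ⟩ u) ≡⟨ ℤΣ.sum-cong-≗ per-edge ⟩
        sum (λ f → on-path a f u - on-path b f u)         ≡⟨ sum-minus (λ f → on-path a f u) (λ f → on-path b f u) ⟩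
        path a u - path b u                               ≡⟨ path-minus a b u ⟩
        ⟨ a ⟩ u - ⟨ b ⟩ u                                 ∎) ⟩
      indegree O u - (⟨ a ⟩ u - ⟨ b ⟩ u)                ∎
      where
      open ≡-Reasoning
      O′ : Edge → Bool
      O′ f = O f xor separates a b f
      split : ∀ x y → y ≡ x - (x - y)
      split = solve-∀
      unreversed : ∀ f → separates a b f ≡ false → ⟨ src (f , O f) ⟩ u - ⟨ src (f , O′ f) ⟩ u ≡ 0ℤ
      unreversed f eq = ℤ.i≡j⇒i-j≡0 (cong (λ c → ⟨ src (f , c) ⟩ u)
        (trans (sym (Bool.xor-identityʳ (O f))) (cong (O f xor_) (sym eq))))
      per-edge : ∀ f → ⟨ src (f , O f) ⟩ u - ⟨ src (f , O′ f) ⟩ u ≡ on-path a f u - on-path b f u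
      per-edge f = bool-case (t f)
        (λ tf → bool-case (separates a b f)
          (λ sep → let sa , Of = downwards f sep in trans
            (cong₂ (λ c c′ → ⟨ src (f , c) ⟩ u - ⟨ src (f , c′) ⟩ u) Of
              (trans (cong₂ _xor_ Of sep) (not-xor-true (first f))))
            (sym (trans (cong₂ _-_ (on-path-true u tf sa) (on-path-false u tf
                (Bool.¬-not λ sb → separates⇒≢ sep (trans sa (sym sb)))))
              (ℤ.+-identityʳ _))))
          (λ sep → trans (unreversed f sep) (sym (ℤ.i≡j⇒i-j≡0
            (cong (λ c → if t f then (if c then _ else 0ℤ) else 0ℤ) (agree tf sep))))))
        (λ tf → trans (unreversed f (cong (_∧ (far-side f a xor far-side f b)) tf))
                      (sym (cong₂ _-_ (if-false tf) (if-false tf))))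
        where
        not-xor-true : ∀ c → not c xor true ≡ c
        not-xor-true true  = refl
        not-xor-true false = refl
        agree : t f ≡ true → separates a b f ≡ false → far-side f a ≡ far-side f b
        agree tf sep with far-side f a Bool.≟ far-side f b
        ... | yes e = e
        ... | no ne = contradiction (trans (sym (cong₂ _∧_ tf (xor-≢ ne))) sep) λ ()

  -- Building a tree from a rooted orientation

  module Greedy (d : Dart) (D : Divisor graph)
                (rooted : ∀ O → indegree O ≗ D → Rooted (src d) O) where

    at : (Edge → Bool) → ℕ → Dart
    at t k = fold d (step t) k

    -- O can be changed, without changing its indegrees or its values before
    -- time j, into an orientation for which the tour would cut y at time j.
    Improvable : (Edge → Bool) → (Edge → Bool) → ℕ → Dart → Set
    Improvable t O j y = ∃[ O′ ] indegree O′ ≗ D ×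
      (∀ i → i ℕ.< j → O′ (edge (at t i)) ≡ O (edge (at t i))) × O′ (edge y) ≡ proj₂ y

    improvable? : ∀ t O j y → Dec (Improvable t O j y)
    improvable? t O j y = any-function?
      (λ {f} {g} eq (ind , same , new) → (λ u → trans (indegree-cong (λ e → sym (eq e)) u) (ind u)) ,
        (λ i i<j → trans (sym (eq _)) (same i i<j)) , trans (sym (eq _)) new)
      (λ O′ → Fin.all? (λ u → indegree O′ u ℤ.≟ D u)
        ×-dec map′ (λ h i i<j → h i<j) (λ h {i} i<j → h i i<j)
                   (ℕ.allUpTo? (λ i → O′ (edge (at t i)) Bool.≟ O (edge (at t i))) j)
        ×-dec (O′ (edge y) Bool.≟ proj₂ y))

    Improvable-transfer : ∀ {t t′ O O′ j y} →
      (∀ i → i ℕ.< j → at t′ i ≡ at t i) → (∀ i → i ℕ.< j → O′ (edge (at t i)) ≡ O (edge (at t i))) →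
      Improvable t′ O′ j y → Improvable t O j y
    Improvable-transfer {t} {t′} {O} {O′} tours same (O″ , ind , same′ , new) = O″ , ind ,
      (λ i i<j → trans (subst (λ z → O″ (edge z) ≡ O′ (edge z)) (tours i i<j) (same′ i i<j)) (same i i<j)) , new

    -- A spanning tree t whose orientation agrees up to time k with an
    -- orientation O of indegree D, where walks were only used if unavoidable.
    record State (k : ℕ) : Set where
      field
        t         : Edge → Bool
        tree      : Tree t
        O         : Edge → Bool
        indeg     : indegree O ≗ D
      module T = TreePaths t tree d
      field
        agrees    : ∀ j → j ℕ.< k → O (edge (at t j)) ≡ T.orient (edge (at t j))
        forced    : ∀ j y → j ℕ.< k → FirstAt t d j y → t (edge y) ≡ true → ¬ Improvable t O j y

    orient-at : ∀ {t} (tree : Tree t) {j y} → FirstAt t d j y →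
                FirstVisits.orient t tree d (edge y) ≡ t (edge y) xor proj₂ y
    orient-at {t} tree {j} {y} f = cong (t (edge y) xor_)
      (FirstVisits.first-unique t tree d (FirstVisits.FirstAt-precedes t tree d f))

    first-visit : ∀ t j → ∃[ i ] ∃[ y ] i ℕ.≤ j × FirstAt t d i y × edge y ≡ edge (at t j)
    first-visit t j with least (λ i → edge (at t i) Fin.≟ edge (at t j)) j refl
    ... | i , eq , min = i , at t i , ℕ.≮⇒≥ (λ j<i → min j j<i refl) ,
                         (refl , λ l l<i e → min l l<i (trans e eq)) , eq

    initial : ∀ {t O} → Tree t → indegree O ≗ D → State 0
    initial {t} {O} tree ind = record
      { t = t ; tree = tree ; O = O ; indeg = ind ; agrees = λ _ () ; forced = λ _ _ () }

    module Step {k : ℕ} (S : State k) where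
      open State S
      open T using (pos; at-pos; orient; first; far-side; far-side-isSide; separates)

      x = at t k

      repeat : (∃[ i ] i ℕ.< k × edge (at t i) ≡ edge x) → State (suc k)
      repeat (i , i<k , eq) = record
        { t = t ; tree = tree ; O = O ; indeg = indeg
        ; agrees = λ j j<1+k → case ℕ.m≤n⇒m<n∨m≡n (ℕ.s≤s⁻¹ j<1+k) of λ
            { (inj₁ j<k)  → agrees j j<k
            ; (inj₂ refl) → subst (λ e → O e ≡ orient e) eq (agrees i i<k) }
        ; forced = λ j y j<1+k f → case ℕ.m≤n⇒m<n∨m≡n (ℕ.s≤s⁻¹ j<1+k) of λ
            { (inj₁ j<k)  → forced j y j<k f
            ; (inj₂ refl) → contradiction (trans eq (cong edge (proj₁ f))) (proj₂ f i i<k) } }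

      module New (new : ∀ i → i ℕ.< k → edge (at t i) ≢ edge x) where

        first-at-x : FirstAt t d k x
        first-at-x = refl , new

        pos-x : pos d x ≡ k
        pos-x = T.FirstAt-pos first-at-x

        x<x* : pos d x ℕ.< pos d (opposite x)
        x<x* = T.FirstAt-precedes first-at-x

        -- All cases at a new edge end here. The invariants for earlier times depend only on `t` and
        -- `O` along the past, which `t′` and `O′` share, so only the conditions at `x` remain to be
        -- checked.
        advance : ∀ {t′ O′} → Tree t′ → AgreeUpTo t t′ d k → indegree O′ ≗ D →
          (∀ i → i ℕ.< k → O′ (edge (at t i)) ≡ O (edge (at t i))) →
          O′ (edge x) ≡ t′ (edge x) xor proj₂ x →
          (t′ (edge x) ≡ true → ¬ Improvable t O′ k x) → State (suc k)
        advance {t′} {O′} tree′ agree ind same at-x forced-x = record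
          { t = t′ ; tree = tree′ ; O = O′ ; indeg = ind
          ; agrees = λ j j<1+k → case ℕ.m≤n⇒m<n∨m≡n (ℕ.s≤s⁻¹ j<1+k) of λ
              { (inj₁ j<k)  → subst (λ z → O′ (edge z) ≡ orient′ (edge z)) (tours j (ℕ.<⇒≤ j<k))
                                (trans (same j j<k) (trans (agrees j j<k) (orient≡ j j<k)))
              ; (inj₂ refl) → subst (λ z → O′ (edge z) ≡ orient′ (edge z)) (tours k ℕ.≤-refl)
                                (trans at-x (sym (orient-at tree′ first-at-x′))) }
          ; forced = λ j y j<1+k f → case ℕ.m≤n⇒m<n∨m≡n (ℕ.s≤s⁻¹ j<1+k) of λ
              { (inj₁ j<k)  t′y improvable →
                  let f₀ = FirstAt-agree (AgreeUpTo-≤ {t′} {t} {d} (ℕ.<⇒≤ j<k) back) f in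
                  forced j y j<k f₀
                    (trans (subst (λ z → t (edge z) ≡ t′ (edge z)) (proj₁ f₀) (agree j j<k)) t′y)
                    (Improvable-transfer {t} {t′} {O} {O′}
                      (λ i i<j → sym (tours i (ℕ.<⇒≤ (ℕ.<-trans i<j j<k))))
                      (λ i i<j → same i (ℕ.<-trans i<j j<k)) improvable)
              ; (inj₂ refl) t′y improvable →
                  let y≡x = trans (sym (proj₁ f)) (sym (tours k ℕ.≤-refl)) in
                  forced-x (subst (λ z → t′ (edge z) ≡ true) y≡x t′y)
                    (Improvable-transfer {t} {t′} {O′} {O′} (λ i i<k → sym (tours i (ℕ.<⇒≤ i<k))) (λ _ _ → refl)
                      (subst (Improvable t′ O′ k) y≡x improvable)) } }
          where
          orient′ = FirstVisits.orient t′ tree′ d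
          tours : ∀ j → j ℕ.≤ k → at t j ≡ at t′ j
          tours = fold-agree t t′ d k agree
          back : AgreeUpTo t′ t d k
          back = AgreeUpTo-sym {t} {t′} {d} agree
          first-at-x′ : FirstAt t′ d k x
          first-at-x′ = FirstAt-agree agree first-at-x
          orient≡ : ∀ j → j ℕ.< k → orient (edge (at t j)) ≡ orient′ (edge (at t j))
          orient≡ j j<k with first-visit t j
          ... | i , y , i≤j , f , eq = subst (λ e → orient e ≡ orient′ e) eq (trans (orient-at tree f)
            (trans (cong (_xor proj₂ y) (subst (λ z → t (edge z) ≡ t′ (edge z)) (proj₁ f) (agree i i<k)))
              (sym (orient-at tree′ (FirstAt-agree (AgreeUpTo-≤ {t} {t′} {d} (ℕ.<⇒≤ i<k) agree) f)))))
            where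
            i<k : i ℕ.< k
            i<k = ℕ.≤-<-trans i≤j j<k

        -- Some edge enters the far side of x in O′; it is not in t, and if it
        -- had been visited before x it would have been cut on the far side.
        cut-instead : ∀ {O′} → indegree O′ ≗ D →
          (∀ i → i ℕ.< k → O′ (edge (at t i)) ≡ O (edge (at t i))) →
          O′ (edge x) ≡ proj₂ x → t (edge x) ≡ true → State (suc k)
        cut-instead {O′} ind same at-x tx
          with T.cut x tx
        ... | s , side with Fin.any? (λ e → (s (src (e , O′ e)) Bool.≟ true) ×-dec (s (src (e , not (O′ e))) Bool.≟ false))
        ...   | yes (e , head-far , tail-near) = advance
            (exchange-tree tree {y = e , O′ e} tx side λ eq → true≢false (trans (sym eq) head-far) tail-near)
            (λ j j<k → sym (exchange-other t (edge x) e (new j j<k) (fresh j j<k)))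
            ind same
            (trans at-x (sym (cong (_xor proj₂ x) (exchange-old t (edge x) e (e≢x ∘ sym)))))
            (λ t′x → ⊥-elim (true≢false t′x (exchange-old t (edge x) e (e≢x ∘ sym))))
          where
          e≢x : e ≢ edge x
          e≢x refl = true≢false head-far (trans (cong (λ b → s (src (edge x , b))) at-x) (IsSide.near side))
          te : t e ≡ false
          te = Bool.¬-not λ te → true≢false head-far (trans (IsSide.uncrossed side (e , O′ e) te e≢x) tail-near)
          fresh : ∀ j → j ℕ.< k → edge (at t j) ≢ e
          fresh j j<k refl with first-visit t j
          ... | i , y , i≤j , f , refl = ℕ.<-irrefl refl (ℕ.<-≤-trans
            (ℕ.<-≤-trans (proj₁ (T.side-true side tx x<x* (trans (cong (λ b → s (src (edge y , b)))
              (sym (trans (same j j<k) (trans (agrees j j<k) (trans (orient-at tree f) (cong (_xor proj₂ y) te)))))) head-far)))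
              (ℕ.≤-trans (ℕ.≤-reflexive (T.FirstAt-pos f)) i≤j))
            (ℕ.≤-trans (ℕ.<⇒≤ j<k) (ℕ.≤-reflexive (sym pos-x))))
        -- If no edge entered the far side, the indicator of the near side would be monotone along
        -- `O′`, with value 1 at the root and 0 at `tgt x`.
        ...   | no none = contradiction
          (ℤ.≤-trans (ℤ.≤-reflexive (sym (if-false (T.side-start side tx x<x*))))
            (ℤ.≤-trans (rooted O′ ind h monotone (tgt x)) (ℤ.≤-reflexive (if-true (IsSide.far side)))))
          λ { (ℤ.+≤+ ()) }
          where
          h : Vertex → ℤ
          h u = if s u then 0ℤ else 1ℤ
          monotone : Monotone h O′
          monotone e with s (src (e , O′ e)) in head | s (src (e , not (O′ e))) in tail
          ... | true  | true  = ℤ.≤-refl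
          ... | false | true  = ℤ.+≤+ z≤n
          ... | false | false = ℤ.≤-refl
          ... | true  | false = contradiction (e , head , tail) none

        -- If the edges of t between the ends of x were all visited already,
        -- then they would form with x a directed cycle of O, and reversing it
        -- would contradict the choice made at the first of them.
        walk-instead : ¬ Improvable t O k x → O (edge x) ≡ not (proj₂ x) → t (edge x) ≡ false → State (suc k)
        walk-instead unimprovable at-x tx
          with Fin.any? (λ f → (separates (src x) (tgt x) f Bool.≟ true) ×-dec
                              ¬? (ℕ.anyUpTo? (λ i → edge (at t i) Fin.≟ f) k))
        -- The edge `f` of the tree path between the ends of `x` is not visited yet: exchanging it
        -- for `x` makes the tour walk along `x` and leaves its past as it was.
        ... | yes (f , sep , fresh) = advance
            (exchange-tree tree {y = x} tf (far-side-isSide tf) (T.separates⇒≢ sep))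
            (λ j j<k → sym (exchange-other t f (edge x) (λ e → fresh (j , j<k , e)) (new j j<k)))
            indeg (λ _ _ → refl)
            (trans at-x (cong (_xor proj₂ x) (sym (exchange-new t f (edge x)))))
            (λ _ → unimprovable)
          where
          tf = T.separates⇒tree sep
        ... | no none = ⊥-elim contradicts
          where
          C : Edge → Bool
          C = separates (src x) (tgt x)
          C-x : C (edge x) ≡ false
          C-x = Bool.¬-not λ c → true≢false (T.separates⇒tree c) tx
          visited : ∀ f → C f ≡ true → ∃[ i ] i ℕ.< k × edge (at t i) ≡ f
          visited f sep with ℕ.anyUpTo? (λ i → edge (at t i) Fin.≟ f) k
          ... | yes v = v
          ... | no ¬v = contradiction (f , sep , ¬v) none
          O₁ : Edge → Bool
          O₁ f = if does (f Fin.≟ edge x) then proj₂ x else O f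
          O₁-x : O₁ (edge x) ≡ proj₂ x
          O₁-x = if-true (dec-true (edge x Fin.≟ edge x) refl)
          O₁-other : ∀ {f} → f ≢ edge x → O₁ f ≡ O f
          O₁-other {f} f≢x = if-false (dec-false (f Fin.≟ edge x) f≢x)
          indegree-O₁ : ∀ u → indegree O₁ u ≡ indegree O u + (⟨ src x ⟩ u - ⟨ tgt x ⟩ u)
          indegree-O₁ u = trans (plus (indegree O₁ u) (indegree O u)) (cong (indegree O u +_)
            (trans (sym (sum-minus (λ f → ⟨ src (f , O₁ f) ⟩ u) (λ f → ⟨ src (f , O f) ⟩ u)))
              (trans (sum-single _ (edge x) λ f f≢x → ℤ.i≡j⇒i-j≡0
                       (cong (λ b → ⟨ src (f , b) ⟩ u) (O₁-other f≢x)))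
                (cong₂ (λ b b′ → ⟨ src (edge x , b) ⟩ u - ⟨ src (edge x , b′) ⟩ u) O₁-x at-x))))
            where
            plus : ∀ a b → a ≡ b + (a - b)
            plus = solve-∀
          downwards : ∀ f → C f ≡ true → far-side f (src x) ≡ true × O₁ f ≡ not (first f)
          downwards f sep with visited f sep
          ... | j , j<k , refl with first-visit t j
          ...   | i , y , i≤j , fy , refl = far-src , trans (O₁-other (new j j<k))
              (trans (agrees j j<k) (cong (_xor first (edge y)) tf))
            where
            tf = T.separates⇒tree sep
            z = T.first-dart (edge y)
            z<z* = T.first-< (edge y)
            pos-z : pos d z ℕ.< pos d x
            pos-z = ℕ.≤-<-trans (ℕ.≤-reflexive (trans
                (cong (λ b → pos d (edge y , b)) (T.first-unique (T.FirstAt-precedes fy))) (T.FirstAt-pos fy)))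
              (ℕ.<-≤-trans (ℕ.≤-<-trans i≤j j<k) (ℕ.≤-reflexive (sym pos-x)))
            -- `x` comes after the first walk along the edge of `y`. If `tgt x` lies beyond that
            -- edge, then `opposite x` does not come after the return, and `x` is still earlier; if
            -- not, `src x` lies beyond it, because the edge separates the two.
            far-src : far-side (edge y) (src x) ≡ true
            far-src = bool-case (far-side (edge y) (tgt x))
              (λ far → T.side-within (far-side-isSide tf) tf z<z* pos-z
                (ℕ.<⇒≤ (ℕ.<-≤-trans x<x* (proj₂ (T.side-true (far-side-isSide tf) tf z<z* {opposite x} far)))))
              (λ near → trans (Bool.¬-not (T.separates⇒≢ sep)) (cong not near))
          O′ : Edge → Bool
          O′ f = O₁ f xor C f
          ind′ : indegree O′ ≗ D
          ind′ u = trans (T.indegree-reverse-path (src x) (tgt x) O₁ downwards u)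
            (trans (cong (_- (⟨ src x ⟩ u - ⟨ tgt x ⟩ u)) (indegree-O₁ u))
              (trans (cancel (indegree O u) (⟨ src x ⟩ u - ⟨ tgt x ⟩ u)) (indeg u)))
            where
            cancel : ∀ a b → (a + b) - b ≡ a
            cancel = solve-∀
          unchanged : ∀ i → i ℕ.< k → C (edge (at t i)) ≡ false → O′ (edge (at t i)) ≡ O (edge (at t i))
          unchanged i i<k c = trans (cong₂ _xor_ (O₁-other (new i i<k)) c) (Bool.xor-identityʳ _)
          contradicts : ⊥
          contradicts with ℕ.anyUpTo? (λ j → C (edge (at t j)) Bool.≟ true) k
          ... | no none = unimprovable (O′ , ind′ ,
                  (λ i i<k → unchanged i i<k (Bool.¬-not λ c → none (i , i<k , c))) ,
                  trans (cong₂ _xor_ O₁-x C-x) (Bool.xor-identityʳ _))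
          ... | yes (j₀ , j₀<k , c₀) with least (λ j → C (edge (at t j)) Bool.≟ true) j₀ c₀
          ...   | j , c , min = forced j y j<k fy (T.separates⇒tree c) (O′ , ind′ ,
                  (λ i i<j → unchanged i (ℕ.<-trans i<j j<k) (Bool.¬-not (min i i<j))) ,
                  trans (cong₂ _xor_ (trans (O₁-other (new j j<k))
                    (trans (agrees j j<k) (trans (orient-at tree fy) (cong (_xor proj₂ y) (T.separates⇒tree c))))) c)
                    (reversed (proj₂ y)))
            where
            y = at t j
            j<k : j ℕ.< k
            j<k = ℕ.≤-<-trans (ℕ.≮⇒≥ λ lt → min j₀ lt c₀) j₀<k
            fy : FirstAt t d j y
            fy = refl , λ i i<j e → min i i<j (trans (cong C e) c)
            reversed : ∀ b → (true xor b) xor true ≡ b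
            reversed true  = refl
            reversed false = refl

        advance-new : State (suc k)
        advance-new with improvable? t O k x
        ... | yes (O′ , ind , same , at-x) = bool-case (t (edge x))
          (cut-instead ind same at-x)
          (λ tx → advance tree (λ _ _ → refl) ind same
            (trans at-x (sym (cong (_xor proj₂ x) tx))) (λ tx′ → ⊥-elim (true≢false tx′ tx)))
        ... | no unimprovable = bool-case (t (edge x))
          (λ tx → advance tree (λ _ _ → refl) indeg (λ _ _ → refl)
            (trans at-x (sym (cong (_xor proj₂ x) tx))) (λ _ → unimprovable))
          (walk-instead unimprovable at-x)
          where
          at-x : O (edge x) ≡ not (proj₂ x)
          at-x = Bool.¬-not λ e → unimprovable (O , indeg , (λ _ _ → refl) , e)

      next-state : State (suc k)
      next-state with ℕ.anyUpTo? (λ i → edge (at t i) Fin.≟ edge x) k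
      ... | yes seen = repeat seen
      ... | no ¬seen = New.advance-new λ i i<k e → ¬seen (i , i<k , e)

    run : ∀ {t O} → Tree t → indegree O ≗ D → ∀ k → State k
    run tree ind zero    = initial tree ind
    run tree ind (suc k) = Step.next-state (run tree ind k)

    orientable : ∀ {t O} → Tree t → indegree O ≗ D →
      ∃[ t′ ] Σ[ tree′ ∈ Tree t′ ] indegree (BernardiTour.orient t′ tree′ d) ≗ D
    orientable tree ind = S.t , S.tree , λ u → trans (indegree-cong (λ e → sym (agrees e)) u) (S.indeg u)
      where
      -- There are `m * 2` darts, so by this time the tour has visited every edge and `O` equals the
      -- orientation of the tour.
      module S = State (run tree ind (m ℕ.* 2))
      agrees : ∀ e → S.O e ≡ S.T.orient e
      agrees e = subst (λ y → S.O (edge y) ≡ S.T.orient (edge y)) (S.T.at-pos d (e , true))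
        (S.agrees (S.T.pos d (e , true)) (S.T.pos-bound d (e , true)))

  -- Classes of orientations and their translates

  MonotoneIn : (Vertex → Bool) → (Vertex → ℤ) → (Edge → Bool) → Set
  MonotoneIn A h O = ∀ e → A (src (e , not (O e))) ≡ true → A (src (e , O e)) ≡ true →
                     h (src (e , not (O e))) ≤ h (src (e , O e))

  -- Grow the set A reached from q, first reversing the cut around A if all of
  -- its edges point into A.
  root-at : ∀ q O₀ → ∃[ O ] indegree O ≃ indegree O₀ × Rooted q O
  root-at q O₀ = grow P enlarge (λ u → does (u Fin.≟ q))
    (dec-true (q Fin.≟ q) refl , O₀ , ≃-reflexive (λ _ → refl) ,
     λ h _ u uq → ℤ.≤-reflexive (cong h (sym (does-true (u Fin.≟ q) uq))))
    where
    -- Reachability of all of `A` from `q`, in the style of `Rooted`, along edges inside `A` alone,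
    -- so that it survives the reversal of the cut around `A`.
    Reached : (Vertex → Bool) → (Edge → Bool) → Set
    Reached A O = ∀ h → MonotoneIn A h O → ∀ u → A u ≡ true → h q ≤ h u
    P : (Vertex → Bool) → Set
    P A = A q ≡ true × ∃[ O ] indegree O ≃ indegree O₀ × Reached A O

    extend : ∀ {A O} → A q ≡ true → indegree O ≃ indegree O₀ → Reached A O → ∀ e →
      A (src (e , not (O e))) ≡ true → A (src (e , O e)) ≡ false →
      ∃[ v ] A v ≡ false × P (insert v A)
    extend {A} {O} Aq lin reached e tail head = v , head , insert-there v A Aq , O , lin , λ h mono u uA →
      let inside = λ u Au → reached h (λ e t₁ t₂ → mono e (insert-there v A t₁) (insert-there v A t₂)) u Au in
      case u Fin.≟ v of λ
        { (yes refl) → ℤ.≤-trans (inside _ tail) (mono e (insert-there v A tail) (insert-here v A))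
        ; (no u≢v) → inside u (trans (sym (updateAt-minimal u v A u≢v)) uA) }
      where
      v = src (e , O e)

    enlarge : ∀ A → P A → (∃[ O ] indegree O ≃ indegree O₀ × Rooted q O) ⊎ (∃[ v ] A v ≡ false × P (insert v A))
    enlarge A (Aq , O , lin , reached)
      with Fin.any? (λ e → (A (src (e , not (O e))) Bool.≟ true) ×-dec (A (src (e , O e)) Bool.≟ false))
    ... | yes (e , tail , head) = inj₂ (extend Aq lin reached e tail head)
    ... | no no-exit
      with Fin.any? (λ e → (A (src (e , not (O e))) Bool.≟ false) ×-dec (A (src (e , O e)) Bool.≟ true))
    ...   | no no-entry = inj₁ (O , lin , λ h mono u →
            reached h (λ e _ _ → mono e) u (trans (connected-constant A constant u q) Aq))
      where
      constant : ∀ y → A (src y) ≡ A (tgt y)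
      constant y = oriented (same-edge {edge y , O (edge y)} {y} refl)
        where
        level : A (src (edge y , O (edge y))) ≡ A (src (edge y , not (O (edge y))))
        level with A (src (edge y , O (edge y))) in head | A (src (edge y , not (O (edge y)))) in tail
        ... | true  | true  = refl
        ... | false | false = refl
        ... | true  | false = contradiction (edge y , tail , head) no-entry
        ... | false | true  = contradiction (edge y , tail , head) no-exit
        oriented : y ≡ (edge y , O (edge y)) ⊎ y ≡ opposite (edge y , O (edge y)) → A (src y) ≡ A (tgt y)
        oriented (inj₁ eq) = subst (λ z → A (src z) ≡ A (tgt z)) (sym eq) level
        oriented (inj₂ eq) = subst (λ z → A (src z) ≡ A (tgt z)) (sym eq)
          (trans (sym level) (cong A (sym (tgt-opposite (edge y , O (edge y))))))
    ...   | yes (e , tail , head) = inj₂ (extend Aq (≃-trans reversed lin) reached′ e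
              (trans (cong (λ b → A (src (e , not b))) O′e) (trans (cong (λ b → A (src (e , b))) (Bool.not-involutive (O e))) head))
              (trans (cong (λ b → A (src (e , b))) O′e) tail))
      where
      crosses : Edge → Bool
      crosses g = A (src (g , not (O g))) xor A (src (g , O g))
      O′ : Edge → Bool
      O′ g = O g xor crosses g
      xor-true-not : ∀ b → b xor true ≡ not b
      xor-true-not true  = refl
      xor-true-not false = refl
      O′e : O′ e ≡ not (O e)
      O′e = trans (cong (O e xor_) (cong₂ _xor_ tail head)) (xor-true-not (O e))
      uncrossed : ∀ {g} → A (src (g , not (O g))) ≡ A (src (g , O g)) → O′ g ≡ O g
      uncrossed {g} eq = trans (cong (λ a → O g xor (a xor A (src (g , O g)))) eq)
        (trans (cong (O g xor_) (Bool.xor-same (A (src (g , O g))))) (Bool.xor-identityʳ (O g)))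
      -- Each reversed edge moves its head from `A` to the complement; together this adds the
      -- Laplacian of the indicator of the complement.
      f : Vertex → ℤ
      f u = if A u then 0ℤ else 1ℤ
      reversed : indegree O′ ≃ indegree O
      reversed = ≃⁺ (f , λ u → trans (sym (sum-minus (λ g → ⟨ src (g , O′ g) ⟩ u) (λ g → ⟨ src (g , O g) ⟩ u)))
          (ℤΣ.sum-cong-≗ (per-edge u)))
        where
        neg : ∀ a b → b - a ≡ (0ℤ - 1ℤ) * (a - b)
        neg = solve-∀
        per-edge : ∀ u g → ⟨ src (g , O′ g) ⟩ u - ⟨ src (g , O g) ⟩ u ≡ edgeFlow graph f u g
        per-edge u g = trans (cases refl refl) (sym (edgeFlow-point f u y))
          where
          y = (g , O g)
          Goal = ⟨ src (g , O′ g) ⟩ u - ⟨ src y ⟩ u ≡ (f (src y) - f (tgt y)) * (⟨ src y ⟩ u - ⟨ tgt y ⟩ u)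
          flat : A (tgt y) ≡ A (src y) → Goal
          flat eq = trans (ℤ.i≡j⇒i-j≡0 (cong (λ b → ⟨ src (g , b) ⟩ u) (uncrossed eq)))
            (sym (trans (cong (_* (⟨ src y ⟩ u - ⟨ tgt y ⟩ u))
                (ℤ.i≡j⇒i-j≡0 (cong (if_then 0ℤ else 1ℤ) (sym eq))))
              (ℤ.*-zeroˡ (⟨ src y ⟩ u - ⟨ tgt y ⟩ u))))
          cases : ∀ {a b} → A (tgt y) ≡ a → A (src y) ≡ b → Goal
          cases {true}  {true}  ea eb = flat (trans ea (sym eb))
          cases {false} {false} ea eb = flat (trans ea (sym eb))
          cases {true}  {false} ea eb = contradiction (g , ea , eb) no-exit
          cases {false} {true}  ea eb = trans
            (cong (λ b → ⟨ src (g , b) ⟩ u - ⟨ src y ⟩ u)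
              (trans (cong (O g xor_) (cong₂ _xor_ ea eb)) (xor-true-not (O g))))
            (trans (neg (⟨ src y ⟩ u) (⟨ tgt y ⟩ u))
              (cong (_* (⟨ src y ⟩ u - ⟨ tgt y ⟩ u)) (sym (cong₂ _-_ (if-true eb) (if-false ea)))))
      reached′ : Reached A O′
      reached′ h mono = reached h λ g tail head → subst (λ b → h (src (g , not b)) ≤ h (src (g , b)))
        (uncrossed (trans tail (sym head)))
        (mono g (trans (cong (λ b → A (src (g , not b))) (uncrossed (trans tail (sym head)))) tail)
                (trans (cong (λ b → A (src (g , b))) (uncrossed (trans tail (sym head)))) head))

  module _ {t₀ : Edge → Bool} (tree₀ : Tree t₀) where

    abstract
      tree-orientation : ∀ d O → ∃[ t ] Σ[ tree ∈ Tree t ] indegree (BernardiTour.orient t tree d) ≃ indegree O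
      tree-orientation d O =
        let O₁ , lin , rooted = root-at (src d) O
            t , tree , eq = Greedy.orientable d (indegree O₁)
              (λ O′ e → Rooted-indegree (λ u → sym (e u)) rooted) {O = O₁} tree₀ (λ _ → refl)
        in  t , tree , ≃-trans (≃-reflexive eq) lin

    Translatable : Divisor graph → Set
    Translatable γ = ∀ O → ∃[ O′ ] indegree O′ ≃ indegree O ⊞ γ

    -- Start the tour at `w`. In its orientation the tree path from `w` to `v` leads away from the
    -- root, and reversing it moves one unit of indegree from `v` to `w`.
    translate-points : Dart → ∀ w v → Translatable (λ u → ⟨ w ⟩ u - ⟨ v ⟩ u)
    translate-points d₀ w v O with dart-at d₀ w
    ... | d , refl with tree-orientation d O
    ...   | t , tree , lin = _ , ≃-trans (≃-reflexive λ u →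
              trans (T.indegree-reverse-path v w T.orient downwards u) (lemma (indegree T.orient u) (⟨ v ⟩ u) (⟨ w ⟩ u)))
              (≃-⊞ lin (≃-reflexive {λ u → ⟨ w ⟩ u - ⟨ v ⟩ u} λ _ → refl))
      where
      module T = TreePaths t tree d
      lemma : ∀ a b c → a - (b - c) ≡ a + (c - b)
      lemma = solve-∀
      downwards : ∀ f → T.separates v w f ≡ true → T.far-side f v ≡ true × T.orient f ≡ not (T.first f)
      downwards f sep =
        let tf = T.separates⇒tree sep
            w-near = T.side-start (T.far-side-isSide tf) tf (T.first-< f)
        in  trans (Bool.¬-not (T.separates⇒≢ sep)) (cong not w-near) , cong (_xor T.first f) tf

    Translatable-cong : ∀ {γ δ} → γ ≗ δ → Translatable γ → Translatable δ
    Translatable-cong {γ} {δ} eq tr O = let O′ , lin = tr O in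
      O′ , ≃-trans lin (≃-⊞ (≃-reflexive {indegree O} λ _ → refl) (≃-reflexive eq))

    Translatable-0 : Translatable (λ _ → 0ℤ)
    Translatable-0 O = O , ≃-reflexive λ u → sym (ℤ.+-identityʳ _)

    Translatable-⊞ : ∀ {γ δ} → Translatable γ → Translatable δ → Translatable (γ ⊞ δ)
    Translatable-⊞ {γ} {δ} trγ trδ O =
      let O₁ , lin₁ = trγ O
          O₂ , lin₂ = trδ O₁
      in  O₂ , ≃-trans lin₂ (≃-trans (≃-⊞ lin₁ (≃-reflexive {δ} λ _ → refl))
                 (≃-reflexive λ u → ℤ.+-assoc (indegree O u) (γ u) (δ u)))

    Translatable-sum : ∀ {k} (F : Fin k → Divisor graph) → (∀ i → Translatable (F i)) →
                       Translatable (λ u → sum λ i → F i u)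
    Translatable-sum {zero}  F tr = Translatable-0
    Translatable-sum {suc k} F tr = Translatable-⊞ (tr zero) (Translatable-sum (F ∘ suc) (tr ∘ suc))

    Translatable-multiple : ∀ {γ} → Translatable γ → Translatable (λ u → - γ u) → ∀ c → Translatable (λ u → c * γ u)
    Translatable-multiple {γ} tr tr⁻ = λ
      { (ℤ.+ n) → naturals tr n
      ; -[1+ n ] → Translatable-cong (λ u → lemma (ℤ.+ suc n) (γ u)) (naturals tr⁻ (suc n)) }
      where
      lemma : ∀ a b → a * - b ≡ - a * b
      lemma = solve-∀
      naturals : ∀ {δ} → Translatable δ → ∀ n → Translatable (λ u → ℤ.+ n * δ u)
      naturals {δ} tr zero    = Translatable-cong (λ u → sym (ℤ.*-zeroˡ (δ u))) Translatable-0
      naturals {δ} tr (suc n) = Translatable-cong (λ u → sym (ℤ.suc-* (ℤ.+ n) (δ u)))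
                                  (Translatable-⊞ tr (naturals tr n))

    -- Degree 0 makes `γ` the combination of the differences `⟨ v ⟩ - ⟨ q ⟩` with coefficients
    -- `γ v`, since the total coefficient of the subtracted `⟨ q ⟩` is the degree.
    degree-0-translatable : Dart → (γ : Div⁰ graph) → Translatable (proj₁ γ)
    degree-0-translatable d (γ , deg) = Translatable-cong expand
      (Translatable-sum (λ v u → γ v * (⟨ v ⟩ u - ⟨ q ⟩ u)) λ v →
        Translatable-multiple (translate-points d v q)
          (Translatable-cong (λ u → lemma (⟨ v ⟩ u) (⟨ q ⟩ u)) (translate-points d q v)) (γ v))
      where
      q = src d
      lemma : ∀ a b → b - a ≡ - (a - b)
      lemma = solve-∀
      distrib : ∀ a b c → a * (b - c) ≡ a * b - a * c
      distrib = solve-∀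
      point-sym : ∀ v u → ⟨ v ⟩ u ≡ ⟨ u ⟩ v
      point-sym v u with v Fin.≟ u
      ... | yes refl = point-≡ {v} refl
      ... | no v≢u   = point-≢ (v≢u ∘ sym)
      expand : ∀ u → sum (λ v → γ v * (⟨ v ⟩ u - ⟨ q ⟩ u)) ≡ γ u
      expand u = trans (ℤΣ.sum-cong-≗ λ v → distrib (γ v) (⟨ v ⟩ u) (⟨ q ⟩ u))
        (trans (sum-minus (λ v → γ v * ⟨ v ⟩ u) (λ v → γ v * ⟨ q ⟩ u))
          (trans (cong₂ _-_
              (trans (ℤΣ.sum-cong-≗ λ v → cong (γ v *_) (point-sym v u)) (sum-point γ u))
              (trans (sym (ℤΣ*.*-distribʳ-sum (⟨ q ⟩ u) γ)) (trans (cong (_* ⟨ q ⟩ u) deg) (ℤ.*-zeroˡ (⟨ q ⟩ u)))))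
            (ℤ.+-identityʳ (γ u))))

  -- Two descriptions of spanning trees

  open SpanningTree

  -- `inside-A` allows a dart from a vertex outside `A` to be put in front without repetitions;
  -- `ends`, by which `u` is met only at the end, allows the walk to be closed to a cycle by a dart
  -- starting at `u`.
  record SimpleWalk (S : Edge → Bool) (A : Vertex → Bool) (w u : Vertex) : Set where
    field
      darts    : List Dart
      is-walk  : IsWalk w darts u
      allowed  : All (λ y → S (edge y) ≡ true) darts
      inside-A : All (λ y → A (src y) ≡ true × A (tgt y) ≡ true) darts
      ends     : All (λ y → src y ≢ u) darts
      vertices : Unique (map src darts)
      edges-unique : Unique (map edge darts)

  reachable : ∀ (S : Edge → Bool) u → ∃[ A ] A u ≡ true ×
    (∀ w → A w ≡ true → SimpleWalk S A w u) × (∀ y → S (edge y) ≡ true → A (src y) ≡ A (tgt y))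
  reachable S u = grow P enlarge (λ w → does (w Fin.≟ u)) (dec-true (u Fin.≟ u) refl , λ w uw → record
      { darts = [] ; is-walk = does-true (w Fin.≟ u) uw ; allowed = [] ; inside-A = [] ; ends = []
      ; vertices = [] ; edges-unique = [] })
    where
    P : (Vertex → Bool) → Set
    P A = A u ≡ true × (∀ w → A w ≡ true → SimpleWalk S A w u)

    Exit : (Vertex → Bool) → Dart → Set
    Exit A y = S (edge y) ≡ true × A (src y) ≡ false × A (tgt y) ≡ true
    exit? : ∀ A y → Dec (Exit A y)
    exit? A y = (S (edge y) Bool.≟ true) ×-dec (A (src y) Bool.≟ false) ×-dec (A (tgt y) Bool.≟ true)

    extend : ∀ A → P A → ∀ y → Exit A y → ∃[ v ] A v ≡ false × P (insert v A)
    extend A (Au , walks) y (Sy , y∉A , y*∈A) = src y , y∉A , insert-there (src y) A Au , walk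
      where
      v = src y
      widen : ∀ {w} → A w ≡ true → SimpleWalk S (insert v A) w u
      widen Aw = record
        { darts = darts ; is-walk = is-walk ; allowed = allowed
        ; inside-A = All.map (λ (s , t) → insert-there v A s , insert-there v A t) inside-A
        ; ends = ends ; vertices = vertices ; edges-unique = edges-unique }
        where open SimpleWalk (walks _ Aw)
      walk : ∀ w → insert v A w ≡ true → SimpleWalk S (insert v A) w u
      walk w Aw with w Fin.≟ v
      ... | no w≢v = widen (trans (sym (updateAt-minimal w v A w≢v)) Aw)
      ... | yes refl = record
        { darts = y ∷ W.darts
        ; is-walk = refl , W.is-walk
        ; allowed = Sy ∷ W.allowed
        ; inside-A = (insert-here v A , insert-there v A y*∈A) ∷ W′.inside-A
        ; ends = (λ eq → true≢false Au (trans (cong A (sym eq)) y∉A)) ∷ W.ends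
        ; vertices = All.map⁺ (All.map (λ (s , _) eq → true≢false s (trans (cong A (sym eq)) y∉A)) W.inside-A) ∷ W.vertices
        ; edges-unique = All.map⁺ (All.map (λ {z} (s , t) eq → case same-edge {z} {y} eq of λ
            { (inj₁ refl) → true≢false s y∉A ; (inj₂ refl) → true≢false t y∉A }) W.inside-A) ∷ W.edges-unique }
        where
        module W = SimpleWalk (walks (tgt y) y*∈A)
        module W′ = SimpleWalk (widen y*∈A)

    enlarge : ∀ A → P A → _ ⊎ (∃[ v ] A v ≡ false × P (insert v A))
    enlarge A inv with Fin.any? (λ e → exit? A (e , false)) | Fin.any? (λ e → exit? A (e , true))
    ... | yes (e , exit) | _ = inj₂ (extend A inv (e , false) exit)
    ... | no _ | yes (e , exit) = inj₂ (extend A inv (e , true) exit)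
    ... | no none₀ | no none₁ = inj₁ (A , proj₁ inv , proj₂ inv , λ y Sy → closed y Sy)
      where
      no-exit : ∀ y → ¬ Exit A y
      no-exit (e , false) exit = none₀ (e , exit)
      no-exit (e , true)  exit = none₁ (e , exit)
      closed : ∀ y → S (edge y) ≡ true → A (src y) ≡ A (tgt y)
      closed y Sy = bool-case (A (src y))
        (λ sy → trans sy (sym (Bool.¬-not λ ty → no-exit (opposite y)
                  (Sy , ty , trans (cong A (tgt-opposite y)) sy))))
        (λ sy → trans sy (sym (Bool.¬-not λ ty → no-exit y (Sy , sy , ty))))

  member : SpanningTree graph → Edge → Bool
  member T e = does (e ∈? edges T)

  member-true : ∀ T {e} → member T e ≡ true → e ∈ edges T
  member-true T {e} = does-true (e ∈? edges T)

  abstract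
    member-tree : ∀ T → Tree (member T)
    member-tree T = record
      { joins = λ p inv u w → let ds , walk , within = connecting T u w in
          constant-on-walk (λ y → edge y ∈ edges T) p
            (λ y y∈T → inv y (dec-true (edge y ∈? edges T) y∈T)) u ds w walk within
      ; cut = fundamental-cut }
      where
      -- `A` is the component of `src x` after the removal of `x`, hence the near side. If it
      -- contained `tgt x`, a simple walk from there back to `src x` would form a cycle with `x`.
      fundamental-cut : ∀ x → member T (edge x) ≡ true → ∃[ s ] IsSide (member T) x s
      fundamental-cut x tx with reachable (updateAt (member T) (edge x) (const false)) (src x)
      ... | A , A-src , walks , closed = not ∘ A , is-side (cong not A-src) (cong not A-tgt)
          λ y ty y≢x → cong not (closed y (trans (updateAt-minimal (edge y) (edge x) (member T) y≢x) ty))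
        where
        A-tgt : A (tgt x) ≡ false
        A-tgt = Bool.¬-not λ far → let open SimpleWalk (walks (tgt x) far) in
          case acyclic T (src x) (x ∷ darts) (refl , is-walk)
            (member-true T tx ∷ All.map (λ {y} Sy → member-true T (trans (sym
              (updateAt-minimal (edge y) (edge x) (member T) (avoids Sy))) Sy)) allowed)
            (All.map⁺ (All.map (λ ne eq → ne (sym eq)) ends) ∷ vertices)
            (All.map⁺ (All.map (λ {y} Sy eq → avoids Sy (sym eq)) allowed) ∷ edges-unique)
          of λ ()
          where
          avoids : ∀ {e} → updateAt (member T) (edge x) (const false) e ≡ true → e ≢ edge x
          avoids Sy refl = true≢false Sy (updateAt-updates (edge x) (member T))

  to-spanning-tree : ∀ {t} → Tree t → SpanningTree graph
  to-spanning-tree {t} tree = record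
    { edges = tabulate t
    ; connecting = λ u w →
        let A , Aw , walks , closed = reachable t w
            open SimpleWalk (walks u (trans (Tree.joins tree A closed u w) Aw))
        in  darts , is-walk , All.map (λ {y} ty → lookup⇒[]= (edge y) (tabulate t)
              (trans (lookup∘tabulate t (edge y)) ty)) allowed
    ; acyclic = no-cycle }
    where
    in-t : ∀ {e} → e ∈ tabulate t → t e ≡ true
    in-t {e} e∈ = trans (sym (lookup∘tabulate t e)) ([]=⇒lookup e∈)
    -- After its first dart `x`, a cycle continues without the edge of `x` and returns from `tgt x`
    -- to `src x`, which the fundamental cut of `x` separates.
    no-cycle : Acyclic (tabulate t)
    no-cycle u []       walk within vs es = refl
    no-cycle u (x ∷ ds) (refl , walk) (x∈ ∷ within) vs (x∉ds ∷ _) with Tree.cut tree x (in-t x∈)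
    ... | s , side = ⊥-elim (true≢false
      (trans (sym (constant-on-walk (λ y → t (edge y) ≡ true × edge y ≢ edge x) s
          (λ y (ty , y≢x) → IsSide.uncrossed side y ty y≢x) (tgt x) ds (src x) walk
          (All.zipWith (λ (y∈ , x≢y) → in-t y∈ , x≢y ∘ sym) (within , All.map⁻ x∉ds))))
        (IsSide.far side)) (IsSide.near side))

  member-to-spanning-tree : ∀ {t} (tree : Tree t) → member (to-spanning-tree tree) ≗ t
  member-to-spanning-tree {t} tree e = trans (does-∈? (tabulate t) e) (lookup∘tabulate t e)

  member-injective : ∀ T T′ → member T ≗ member T′ → edges T ≡ edges T′
  member-injective T T′ eq = trans (sym (tabulate∘lookup (edges T))) (trans
    (tabulate-cong λ e → trans (sym (does-∈? (edges T) e)) (trans (eq e) (does-∈? (edges T′) e)))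
    (tabulate∘lookup (edges T′)))

  orient-cong : ∀ {t t′} (tree : Tree t) (tree′ : Tree t′) d → t ≗ t′ →
    FirstVisits.orient t tree d ≗ FirstVisits.orient t′ tree′ d
  orient-cong {t} {t′} tree tree′ d eq e = cong₂ _xor_ (eq e)
    (sym (B′.first-unique (B′.FirstAt-precedes (FirstAt-agree {t} {t′} (λ j _ → eq _)
      (B.precedes-FirstAt (B.first-< e))))))
    where
    module B = FirstVisits t tree d
    module B′ = FirstVisits t′ tree′ d

  -- Bernardi divisors and the action

  module Tour (T : SpanningTree graph) (d : Dart) where
    open FirstVisits (member T) (member-tree T) d public

  bernardi-divisor : Dart → SpanningTree graph → Divisor graph
  bernardi-divisor d T = Tour.bernardi T d

  module _ (d : Dart) (T : SpanningTree graph) where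
    open Tour T d

    -- Between cutting through an edge at both of its ends, the tour has to
    -- walk along some edge, so it cannot have ended before the first time.
    first-cut : ∀ e → e ∉ edges T → FirstCut R T d (e , first e)
    first-cut e e∉T = pos d x , not-ended , FirstAt-x
      where
      x = (e , first e)
      FirstAt-x = precedes-FirstAt (first-< e)
      not-ended : ¬ Ended R T d (pos d x)
      not-ended ended = loopless x (constant-on-arc src d (ℕ.<⇒≤ (first-< e)) λ w x≤w _ →
        bool-case (member T (edge w))
          (λ tw → let j , j<x , at-j = ended w (member-true T tw) in
            contradiction x≤w (ℕ.<⇒≱ (ℕ.≤-<-trans (pos-least at-j) j<x)))
          (λ tw → τ-cotree tw))

    bernardi-isBernardi : IsBernardi R d T (bernardi-divisor d T)
    bernardi-isBernardi = first , first-cut , λ _ → refl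

    isBernardi-unique : ∀ {D} → IsBernardi R d T D → D ≗ bernardi-divisor d T
    isBernardi-unique (c , cuts , eq) u = trans (eq u) (ℤΣ.sum-cong-≗ λ e → bool-case (member T e)
      (λ te → trans (if-true te) (sym (if-true te)))
      (λ te → cong (λ b → if member T e then 0ℤ else ⟨ src (e , b) ⟩ u) (sym
        (let k , _ , first-at = cuts e (does-false (e ∈? edges T) te) in
         first-unique (FirstAt-precedes {k} first-at)))))

  -- The break divisor demanded by `IsTranslate` comes from `T′` itself with the ends chosen by its
  -- tour, so the relation reduces to an equation between classes.
  action⇔ : ∀ d (γ : Div⁰ graph) T T′ → BernardiAction R d γ T T′ ⇔
            bernardi-divisor d T′ ≃ bernardi-divisor d T ⊞ proj₁ γ
  action⇔ d γ T T′ = mk⇔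
    (λ (D , D′ , isD , (_ , lin) , isD′) →
      ≃-trans (≃-reflexive λ u → sym (isBernardi-unique d T′ isD′ u))
        (≃-trans {D′} (≃⁺ lin) (≃-⊞ (≃-reflexive (isBernardi-unique d T isD)) (≃-reflexive {proj₁ γ} λ _ → refl))))
    (λ lin → _ , _ , bernardi-isBernardi d T ,
      ((T′ , _ , λ _ → refl) , ≃⁻ lin) , bernardi-isBernardi d T′)

  ≃-cancel : ∀ {D D′} E → D ⊞ E ≃ D′ ⊞ E → D ≃ D′
  ≃-cancel {D} {D′} E (≃⁺ (f , eq)) = ≃⁺ (f , λ u → trans (lemma (D u) (D′ u) (E u)) (eq u))
    where
    lemma : ∀ a b c → a - b ≡ (a + c) - (b + c)
    lemma = solve-∀

  ⊞-swap : ∀ D E F → D ⊞ E ⊞ F ≃ D ⊞ F ⊞ E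
  ⊞-swap D E F = ≃-reflexive λ u → lemma (D u) (E u) (F u)
    where
    lemma : ∀ a b c → a + b + c ≡ a + c + b
    lemma = solve-∀

  ⊞-congˡ : ∀ {D D′} E → D ≃ D′ → D ⊞ E ≃ D′ ⊞ E
  ⊞-congˡ E lin = ≃-⊞ lin (≃-reflexive {E} λ _ → refl)

  module _ (planar : Planar R) where

    Parallel : Dart → Dart → Set
    Parallel d d′ = ∃[ δ ] ∀ T → bernardi-divisor d T ≃ bernardi-divisor d′ T ⊞ δ

    parallel-refl : ∀ {d} → Parallel d d
    parallel-refl = (λ _ → 0ℤ) , λ T → ≃-reflexive λ u → sym (ℤ.+-identityʳ _)

    parallel-trans : ∀ {d d′ d″} → Parallel d d′ → Parallel d′ d″ → Parallel d d″
    parallel-trans {d} {d′} {d″} (δ , p) (δ′ , p′) = δ′ ⊞ δ , λ T → ≃-trans (p T)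
      (≃-trans (⊞-congˡ δ (p′ T)) (≃-reflexive λ u → ℤ.+-assoc (bernardi-divisor d″ T u) (δ′ u) (δ u)))

    parallel-succ : ∀ d → Parallel d (succ d)
    parallel-succ d = arrow d , λ T → Shifts.shift-succ (member T) (member-tree T) d

    parallel-opposite : ∀ d → Parallel d (opposite d)
    parallel-opposite d = arrow d , λ T → Shifts.shift-opposite (member T) (member-tree T)
      (no-interlacing planar (member T) (member-tree T)) d

    parallel-src : ∀ d d′ → src d ≡ src d′ → Parallel d d′
    parallel-src d d′ eq with succ-cycle d d′ eq
    ... | k , refl = go k
      where
      go : ∀ k → Parallel d (fold d succ k)
      go zero    = parallel-refl
      go (suc k) = parallel-trans (go k) (parallel-succ (fold d succ k))

    parallel : ∀ d d′ → Parallel d d′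
    parallel d d′ = let ds , walk , _ = connected (src d) (src d′) in go d ds refl walk
      where
      go : ∀ x ds {u} → src x ≡ u → IsWalk u ds (src d′) → Parallel x d′
      go x []       refl eq           = parallel-src x d′ eq
      go x (y ∷ ds) refl (eq , walk) = parallel-trans (parallel-src x y (sym eq))
        (parallel-trans (parallel-opposite y) (go (opposite y) ds refl walk))

    action-parallel : ∀ d d′ γ T T′ → BernardiAction R d γ T T′ → BernardiAction R d′ γ T T′
    action-parallel d d′ γ T T′ action =
      let δ , p = parallel d d′ in Equivalence.from (action⇔ d′ γ T T′) (≃-cancel δ
        (≃-trans (≃-sym (p T′)) (≃-trans (Equivalence.to (action⇔ d γ T T′) action)
          (≃-trans (⊞-congˡ (proj₁ γ) (p T)) (⊞-swap (bernardi-divisor d′ T) δ (proj₁ γ))))))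

  module _ (d : Dart) where
    private
      q = src d

    tour-orientation : SpanningTree graph → Edge → Bool
    tour-orientation T = Tour.orient T d

    root-correction : Divisor graph
    root-correction u = 1ℤ - ⟨ q ⟩ u

    indegree-tour : ∀ T → indegree (tour-orientation T) ≃ bernardi-divisor d T ⊞ root-correction
    indegree-tour T = ≃-reflexive (Tour.indegree-orient T d)

    bernardi-injective : ∀ T T′ → bernardi-divisor d T ≃ bernardi-divisor d T′ →
                         edges T ≡ edges T′
    bernardi-injective T T′ lin = member-injective T T′
      (orient-injective (member-tree T) (member-tree T′) d
        (Rooted-unique (Tour.orient-rooted T d) (Tour.orient-rooted T′ d)
          (≃-trans (indegree-tour T) (≃-trans (⊞-congˡ root-correction lin) (≃-sym (indegree-tour T′))))))

    abstract
      -- Translate the orientation of the tour of `T` by `γ` and replace the result by the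
      -- orientation of a tour in its class. Both tours start at `q`, so their indegrees differ from
      -- the Bernardi divisors by the same `root-correction`, which cancels.
      translate-tree : ∀ (γ : Div⁰ graph) T → ∃[ T′ ] bernardi-divisor d T′ ≃ bernardi-divisor d T ⊞ proj₁ γ
      translate-tree γ T =
        let O , O-lin = degree-0-translatable (member-tree T) d γ (tour-orientation T)
            t , tree , t-lin = tree-orientation (member-tree T) d O
            T′ = to-spanning-tree tree
            same = orient-cong (member-tree T′) tree d (member-to-spanning-tree tree)
        in  T′ , ≃-cancel root-correction
              (≃-trans (≃-sym (indegree-tour T′)) (≃-trans (≃-reflexive (indegree-cong same))
                (≃-trans t-lin (≃-trans O-lin (≃-trans (⊞-congˡ (proj₁ γ) (indegree-tour T))
                  (⊞-swap (bernardi-divisor d T) root-correction (proj₁ γ)))))))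

    act : Div⁰ graph → SpanningTree graph → SpanningTree graph
    act γ T = proj₁ (translate-tree γ T)

    bernardi-act : ∀ (γ : Div⁰ graph) T → bernardi-divisor d (act γ T) ≃ bernardi-divisor d T ⊞ proj₁ γ
    bernardi-act γ T = proj₂ (translate-tree γ T)

    act-unique : ∀ (γ : Div⁰ graph) T T′ → bernardi-divisor d T′ ≃ bernardi-divisor d T ⊞ proj₁ γ →
                 edges T′ ≡ edges (act γ T)
    act-unique γ T T′ lin = bernardi-injective T′ (act γ T) (≃-trans lin (≃-sym (bernardi-act γ T)))

    bernardi-cong : ∀ T T′ → edges T ≡ edges T′ →
                    bernardi-divisor d T ≃ bernardi-divisor d T′
    bernardi-cong T T′ eq = ≃-cancel root-correction (≃-trans (≃-sym (indegree-tour T)) (≃-trans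
      (≃-reflexive (indegree-cong (orient-cong (member-tree T) (member-tree T′) d
        (λ e → cong (λ S → does (e ∈? S)) eq)))) (indegree-tour T′)))

    action : Action (Pic⁰ graph) (SpanningTrees graph)
    action = record
      { _▷_      = act
      ; ▷-cong   = λ {γ} {δ} {T} {T′} γ∼δ T≈T′ → act-unique δ T′ (act γ T)
          (≃-trans (bernardi-act γ T) (≃-⊞ (bernardi-cong T T′ T≈T′) (≃⁺ γ∼δ)))
      ; identity = λ T → sym (act-unique G.ε T T (≃-reflexive λ u → sym (ℤ.+-identityʳ _)))
      ; compat   = λ γ δ T → sym (act-unique (γ G.∙ δ) T (act γ (act δ T))
          (≃-trans (bernardi-act γ (act δ T)) (≃-trans (⊞-congˡ (proj₁ γ) (bernardi-act δ T))
            (≃-reflexive λ u → lemma (bernardi-divisor d T u) (proj₁ δ u) (proj₁ γ u)))))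
      }
      where
      module G = AbelianGroup (Pic⁰ graph)
      lemma : ∀ a b c → a + b + c ≡ a + (c + b)
      lemma = solve-∀

    action-correct : ∀ γ T T′ → BernardiAction R d γ T T′ ⇔
                     edges T′ ≡ edges (act γ T)
    action-correct γ T T′ = mk⇔
      (λ a → act-unique γ T T′ (Equivalence.to (action⇔ d γ T T′) a))
      (λ eq → Equivalence.from (action⇔ d γ T T′)
        (≃-trans (bernardi-cong T′ (act γ T) eq) (bernardi-act γ T)))

theorem5p1 : (R : RibbonGraph) → Planar R →
    let open RibbonGraph R
        S = SpanningTrees graph
        open Setoid S using (_≈_)
    in
    ((v v′ : Vertex) (d d′ : Dart) → src d ≡ v → src d′ ≡ v′ →
     (γ : Div⁰ graph) (T T′ : SpanningTree graph) →
       BernardiAction R d γ T T′ ⇔ BernardiAction R d′ γ T T′)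
    ×
    (Σ[ β ∈ Action (Pic⁰ graph) S ]
       ((v : Vertex) (d : Dart) → src d ≡ v →
        (γ : Div⁰ graph) (T T′ : SpanningTree graph) →
          BernardiAction R d γ T T′ ⇔ (T′ ≈ Action._▷_ β γ T)))
theorem5p1 R planar = independent , canonical
  where
  open RibbonGraph R
  open Ribbon R

  independent : (v v′ : Vertex) (d d′ : Dart) → src d ≡ v → src d′ ≡ v′ →
    (γ : Div⁰ graph) (T T′ : SpanningTree graph) →
    BernardiAction R d γ T T′ ⇔ BernardiAction R d′ γ T T′
  independent _ _ d d′ _ _ γ T T′ = mk⇔ (action-parallel planar d d′ γ T T′) (action-parallel planar d′ d γ T T′)

  canonical : Σ[ β ∈ Action (Pic⁰ graph) (SpanningTrees graph) ]
    ((v : Vertex) (d : Dart) → src d ≡ v → (γ : Div⁰ graph) (T T′ : SpanningTree graph) →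
      BernardiAction R d γ T T′ ⇔ SpanningTree.edges T′ ≡ SpanningTree.edges (Action._▷_ β γ T))
  canonical with Fin.any? {n = m} (λ _ → yes tt)
  ... | yes (e , _) = action (e , false) , λ v d _ γ T T′ → mk⇔
    (λ a → Equivalence.to (action-correct (e , false) γ T T′) (action-parallel planar d (e , false) γ T T′ a))
    (λ eq → action-parallel planar (e , false) d γ T T′ (Equivalence.from (action-correct (e , false) γ T T′) eq))
  -- Without edges there are no darts, so there is no starting dart to compare with, and the trivial
  -- action serves.
  ... | no edgeless = record
    { _▷_ = λ _ T → T ; ▷-cong = λ _ eq → eq ; identity = λ _ → refl ; compat = λ _ _ _ → refl } ,
    λ v d _ → ⊥-elim (edgeless (edge d , tt))
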